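{- For integers $a,b\ge 1$ and $n\ge 0$, let $N_{a,b}(n)$ be the number of partitions $\lambda$ of $n$ with pairing index $T(\lambda)=a$ and pairing width $W(\lambda)=b$. Then for all $a,b\geq 1$, $$\sum_{n\geq0}N_{a,b}(n)q^n=q^{a+b-1}\genfrac{[}{]}{0pt}{}{a+b-2}{a-1}_{q}.$$
   Context: For an integer partition $\lambda$, pair equal parts of $\lambda$ as far as possible: for each part size occurring with odd multiplicity exactly one copy remains unpaired, and a part size of even multiplicity is completely paired. Let $r(\lambda)$ be the largest part size that participates in at least one pair (i.e. of multiplicity at least $2$), with $r(\lambda)=0$ if $\lambda$ has distinct parts. Write the unpaired parts (the part sizes of odd multiplicity, each once) in decreasing order $u_1>u_2>\cdots>u_j$ and let $s(\lambda)=u_1-u_2+u_3-u_4+\cdots$ (so $s(\lambda)=0$ if there are no unpaired parts). The pairing index of $\lambda$ is $T(\lambda)=r(\lambda)+s(\lambda)$. The pair span of $\lambda$ is the number of parts of $\lambda$ (counted with multiplicity) that belong to pairs. The residual span of $\lambda$ is $2\bigl(u_1-s(\lambda)\bigr)+1$ if there is at least one unpaired part, and $0$ if there are no unpaired parts. The pairing width $W(\lambda)$ is the larger of the pair span and the residual span. The Gaussian binomial coefficient is $\genfrac{[}{]}{0pt}{}{A}{B}_{q}=\frac{(q;q)_A}{(q;q)_B(q;q)_{A-B}}$ for $0\le B\le A$ and $0$ otherwise, where $(q;q)_N=\prod_{j=1}^{N}(1-q^j)$. -}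

module Defs where

open import Data.Bool.Base using (if_then_else_)
open import Data.Fin.Base using (toℕ)
open import Data.Integer.Base as ℤ using (ℤ; +_; 0ℤ; 1ℤ)
import Data.Integer.Properties as ℤ
open import Data.Integer.Tactic.RingSolver using (solve-∀)
open import Data.List.Base
  using (List; []; _∷_; [_]; _++_; length; map; filter; deduplicate; replicate;
         upTo; concatMap)
open import Data.List.Extrema.Nat using (max)
open import Data.List.Membership.Propositional using (_∈_; find; lose)
open import Data.List.Membership.Propositional.Properties
  using (∈-map⁺; ∈-map⁻; ∈-concatMap⁺; ∈-concatMap⁻; ∈-upTo⁺; ∈-upTo⁻)
open import Data.List.Relation.Unary.All as All using (All; []; _∷_)
import Data.List.Relation.Unary.All.Properties as All
open import Data.List.Relation.Unary.AllPairs as AllPairs using (AllPairs; []; _∷_)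
import Data.List.Relation.Unary.AllPairs.Properties as AllPairs
open import Data.List.Relation.Unary.Any using (here)
open import Data.List.Relation.Unary.Linked using (Linked)
open import Data.List.Relation.Unary.Linked.Properties
  using (AllPairs⇒Linked; Linked⇒AllPairs)
open import Data.List.Relation.Unary.Unique.Propositional using (Unique)
import Data.List.Relation.Unary.Unique.Propositional.Properties as Unique
open import Data.List.Properties using (++-cancelˡ; ∷-injectiveʳ)
open import Data.Nat.Base
open import Data.Nat.ListAction using (sum)
open import Data.Nat.DivMod
  using (_/_; _%_; m/n*n≤m; m*n/n≡m; /-monoˡ-≤)
open import Data.Nat.Properties
open import Data.Product.Base using (∃₂; _×_; _,_)
open import Function.Base using (_∘_; flip)
open import Relation.Binary.PropositionalEquality hiding ([_])
open import Relation.Nullary.Decidable using (dec-true)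
open import Relation.Nullary using (does; yes; no; contradiction; _×-dec_)

open import Algebra.Properties.Semiring.Sum ℤ.+-*-semiring
  using (sum⁺-syntax)

record IsPartition (n : ℕ) (xs : List ℕ) : Set where
  field
    decreasing : Linked _≥_ xs
    positive   : All (0 <_) xs
    total      : sum xs ≡ n

-- The partitions of n into parts ≤ m, grouped by the multiplicity k of
-- the part m.
partitionsBounded : ℕ → ℕ → List (List ℕ)
partitionsBounded zero    zero    = [ [] ]
partitionsBounded zero    (suc _) = []
partitionsBounded (suc m) n       =
  concatMap (λ k → map (replicate k (suc m) ++_)
                       (partitionsBounded m (n ∸ k * suc m)))
            (upTo (suc (n / suc m)))

-- By ∈-partitions⁺, ∈-partitions⁻ and partitions-unique below, this
-- lists every partition of n exactly once.
partitions : ℕ → List (List ℕ)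
partitions n = partitionsBounded n n

multiplicity : List ℕ → ℕ → ℕ
multiplicity xs m = length (filter (m ≟_) xs)

-- deduplicate keeps the order, so for a partition both lists below are
-- strictly decreasing.
sizes : List ℕ → List ℕ
sizes = deduplicate _≟_

unpaired : List ℕ → List ℕ
unpaired xs = filter (λ m → multiplicity xs m % 2 ≟ 1) (sizes xs)

largestPaired : List ℕ → ℕ
largestPaired xs = max 0 (filter (λ m → 2 ≤? multiplicity xs m) xs)

-- u₁ - u₂ + u₃ - ⋯ = u₁ - (u₂ - u₃ + ⋯)
alternatingSum : List ℕ → ℤ
alternatingSum []       = 0ℤ
alternatingSum (u ∷ us) = + u ℤ.- alternatingSum us

pairingIndex : List ℕ → ℤ
pairingIndex xs = + largestPaired xs ℤ.+ alternatingSum (unpaired xs)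

-- A size of multiplicity c contributes ⌊c/2⌋ pairs.
pairSpan : List ℕ → ℕ
pairSpan xs = sum (map (λ m → 2 * (multiplicity xs m / 2)) (sizes xs))

residualSpanOf : List ℕ → ℤ
residualSpanOf []       = 0ℤ
residualSpanOf (u ∷ us) = + 2 ℤ.* (+ u ℤ.- alternatingSum (u ∷ us)) ℤ.+ 1ℤ

residualSpan : List ℕ → ℤ
residualSpan xs = residualSpanOf (unpaired xs)

pairingWidth : List ℕ → ℤ
pairingWidth xs = + pairSpan xs ℤ.⊔ residualSpan xs

N : ℕ → ℕ → ℕ → ℕ
N a b n = length (filter (λ xs → (pairingIndex xs ℤ.≟ + a) ×-dec
                                 (pairingWidth xs ℤ.≟ + b))
                         (partitions n))

-- Formal power series in q over ℤ, as coefficient sequences; equality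
-- of series is _≗_.
Series : Set
Series = ℕ → ℤ

generatingFunction : (ℕ → ℕ) → Series
generatingFunction c n = + c n

0ˢ : Series
0ˢ _ = 0ℤ

q^_ : ℕ → Series
(q^ k) n = if n ≡ᵇ k then 1ℤ else 0ℤ

1ˢ : Series
1ˢ = q^ 0

infixl 6 _-ˢ_
infixl 7 _*ˢ_ _/ˢ_
infix  8 q^_

_-ˢ_ : Series → Series → Series
(f -ˢ g) n = f n ℤ.- g n

_*ˢ_ : Series → Series → Series
(f *ˢ g) n = ∑[ i ≤ n ] (f (toℕ i) ℤ.* g (n ∸ toℕ i))

-- Long division by a series with constant term 1: writing f = f₀ + q f′
-- and g = 1 + q g′, one has f / g = f₀ + q ((f′ - f₀ g′) / g).
-- /ˢ-*ˢ shows that this inverts multiplication by g.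
_/ˢ_ : Series → Series → Series
(f /ˢ g) zero    = f 0
(f /ˢ g) (suc n) = ((λ k → f (suc k) ℤ.- f 0 ℤ.* g (suc k)) /ˢ g) n

qPochhammer : ℕ → Series
qPochhammer zero    = 1ˢ
qPochhammer (suc N) = qPochhammer N *ˢ (1ˢ -ˢ q^ suc N)

gaussianBinomial : ℕ → ℕ → Series
gaussianBinomial A B =
  if does (B ≤? A)
  then qPochhammer A /ˢ (qPochhammer B *ˢ qPochhammer (A ∸ B))
  else 0ˢ

/ˢ-*ˢ : ∀ f g → g 0 ≡ 1ℤ → (f /ˢ g) *ˢ g ≗ f
/ˢ-*ˢ f g g₀ zero rewrite g₀ = trans (ℤ.+-identityʳ _) (ℤ.*-identityʳ _)
/ˢ-*ˢ f g g₀ (suc n) = begin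
  f 0 ℤ.* g (suc n) ℤ.+ ((f′ /ˢ g) *ˢ g) n
    ≡⟨ cong (ℤ._+_ (f 0 ℤ.* g (suc n))) (/ˢ-*ˢ f′ g g₀ n) ⟩
  f 0 ℤ.* g (suc n) ℤ.+ (f (suc n) ℤ.- f 0 ℤ.* g (suc n))
    ≡⟨ cancel (f 0 ℤ.* g (suc n)) (f (suc n)) ⟩
  f (suc n) ∎
  where
  open ≡-Reasoning
  f′ : Series
  f′ k = f (suc k) ℤ.- f 0 ℤ.* g (suc k)
  cancel : ∀ x y → x ℤ.+ (y ℤ.- x) ≡ y
  cancel = solve-∀

*ˢ-constant : ∀ f g → f 0 ≡ 1ℤ → g 0 ≡ 1ℤ → (f *ˢ g) 0 ≡ 1ℤ
*ˢ-constant f g f₀ g₀ rewrite f₀ | g₀ = refl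

qPochhammer-constant : ∀ N → qPochhammer N 0 ≡ 1ℤ
qPochhammer-constant zero    = refl
qPochhammer-constant (suc N) =
  *ˢ-constant (qPochhammer N) (1ˢ -ˢ q^ suc N) (qPochhammer-constant N) refl

gaussianBinomial-* : ∀ {A B} → B ≤ A →
  gaussianBinomial A B *ˢ (qPochhammer B *ˢ qPochhammer (A ∸ B)) ≗ qPochhammer A
gaussianBinomial-* {A} {B} B≤A =
  subst (λ f → f *ˢ divisor ≗ qPochhammer A)
        (sym (cong (if_then qPochhammer A /ˢ divisor else 0ˢ) (dec-true (B ≤? A) B≤A)))
        (/ˢ-*ˢ (qPochhammer A) divisor
          (*ˢ-constant (qPochhammer B) (qPochhammer (A ∸ B))
                       (qPochhammer-constant B) (qPochhammer-constant (A ∸ B))))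
  where divisor = qPochhammer B *ˢ qPochhammer (A ∸ B)

private
  Bounded : ℕ → List ℕ → Set
  Bounded m xs = AllPairs _≥_ xs × All (0 <_) xs × All (_≤ m) xs

  prepend : ∀ {m} k {ys} → Bounded m ys →
            Bounded (suc m) (replicate k (suc m) ++ ys)
  prepend zero    (d , p , b) = d , p , All.map m≤n⇒m≤1+n b
  prepend (suc k) h with prepend k h
  ... | d , p , b = (b ∷ d) , (z<s ∷ p) , (≤-refl ∷ b)

  split : ∀ {m} xs → Bounded (suc m) xs →
          ∃₂ λ k ys → xs ≡ replicate k (suc m) ++ ys × Bounded m ys
  split [] _ = 0 , [] , refl , [] , [] , []
  split {m} (x ∷ xs) (x≥ ∷ d , 0<x ∷ p , x≤ ∷ b) with x ≟ suc m
  ... | yes refl with split xs (d , p , b)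
  ...   | k , ys , refl , h = suc k , ys , refl , h
  split {m} (x ∷ xs) (x≥ ∷ d , 0<x ∷ p , x≤ ∷ b) | no x≢ =
    0 , x ∷ xs , refl , (x≥ ∷ d) , (0<x ∷ p) ,
    (x≤m ∷ All.map (flip ≤-trans x≤m) x≥)
    where x≤m = ≤-pred (≤∧≢⇒< x≤ x≢)

  sum-prepend : ∀ k s ys → sum (replicate k s ++ ys) ≡ k * s + sum ys
  sum-prepend zero    s ys = refl
  sum-prepend (suc k) s ys =
    trans (cong (_+_ s) (sum-prepend k s ys)) (sym (+-assoc s (k * s) (sum ys)))

  sound : ∀ m n {xs} → xs ∈ partitionsBounded m n → Bounded m xs × sum xs ≡ n
  sound zero    zero (here refl) = ([] , [] , []) , refl
  sound (suc m) n xs∈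
    with find (∈-concatMap⁻ _ {xs = upTo (suc (n / suc m))} xs∈)
  ... | k , k∈ , xs∈′ with ∈-map⁻ (replicate k (suc m) ++_) xs∈′
  ...   | ys , ys∈ , refl with sound m (n ∸ k * suc m) ys∈
  ...     | h , eq = prepend k h ,
    trans (sum-prepend k (suc m) ys)
          (trans (cong (_+_ (k * suc m)) eq) (m+[n∸m]≡n k*s≤n))
    where
    k*s≤n : k * suc m ≤ n
    k*s≤n = ≤-trans (*-monoˡ-≤ (suc m) (≤-pred (∈-upTo⁻ k∈))) (m/n*n≤m n (suc m))

  complete : ∀ m n xs → Bounded m xs → sum xs ≡ n → xs ∈ partitionsBounded m n
  complete zero    _ []       _ refl = here refl
  complete zero    _ (x ∷ xs) (_ , 0<x ∷ _ , x≤0 ∷ _) _ =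
    contradiction (≤-trans 0<x x≤0) (λ ())
  complete (suc m) _ xs       h refl with split xs h
  ... | k , ys , refl , h′ rewrite sum-prepend k (suc m) ys =
    ∈-concatMap⁺ _ (lose (∈-upTo⁺ (s≤s k≤))
      (∈-map⁺ _ (complete m _ ys h′ (sym (m+n∸m≡n (k * suc m) (sum ys))))))
    where
    k≤ : k ≤ (k * suc m + sum ys) / suc m
    k≤ = ≤-trans (≤-reflexive (sym (m*n/n≡m k (suc m))))
                 (/-monoˡ-≤ (suc m) (m≤m+n (k * suc m) (sum ys)))

  replicate-injective : ∀ {m} i j {ys zs} → All (_≤ m) ys → All (_≤ m) zs →
    replicate i (suc m) ++ ys ≡ replicate j (suc m) ++ zs → i ≡ j
  replicate-injective zero    zero    _       _       _    = refl
  replicate-injective zero    (suc j) (p ∷ _) _       refl = contradiction p (<⇒≱ ≤-refl)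
  replicate-injective (suc i) zero    _       (p ∷ _) refl = contradiction p (<⇒≱ ≤-refl)
  replicate-injective (suc i) (suc j) ps      qs      eq   =
    cong suc (replicate-injective i j ps qs (∷-injectiveʳ eq))

  unique : ∀ m n → Unique (partitionsBounded m n)
  unique zero    zero    = [] ∷ []
  unique zero    (suc n) = []
  unique (suc m) n       = Unique.concat⁺
    (All.map⁺ (All.universal
      (λ k → Unique.map⁺ (++-cancelˡ (replicate k (suc m)) _ _)
                         (unique m (n ∸ k * suc m))) _))
    (AllPairs.map⁺ (AllPairs.map disjoint (Unique.upTo⁺ (suc (n / suc m)))))
    where
    block : ℕ → List (List ℕ)
    block k = map (replicate k (suc m) ++_) (partitionsBounded m (n ∸ k * suc m))

    disjoint : ∀ {i j} → i ≢ j → ∀ {v} → v ∈ block i × v ∈ block j → _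
    disjoint {i} {j} i≢j (v∈i , v∈j)
      with ∈-map⁻ (replicate i (suc m) ++_) v∈i | ∈-map⁻ (replicate j (suc m) ++_) v∈j
    ... | ys , ys∈ , refl | zs , zs∈ , eq
      with sound m _ ys∈ | sound m _ zs∈
    ... | (_ , _ , b) , _ | (_ , _ , c) , _ = i≢j (replicate-injective i j b c eq)

  parts≤sum : ∀ xs → All (_≤ sum xs) xs
  parts≤sum []       = []
  parts≤sum (x ∷ xs) =
    m≤m+n x (sum xs) ∷ All.map (flip ≤-trans (m≤n+m (sum xs) x)) (parts≤sum xs)

∈-partitions⁺ : ∀ {n xs} → IsPartition n xs → xs ∈ partitions n
∈-partitions⁺ {xs = xs} record { decreasing = d ; positive = p ; total = refl } =
  complete _ _ xs (Linked⇒AllPairs (flip ≤-trans) d , p , parts≤sum xs) refl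

∈-partitions⁻ : ∀ {n xs} → xs ∈ partitions n → IsPartition n xs
∈-partitions⁻ {n} xs∈ with sound n n xs∈
... | (d , p , _) , eq =
  record { decreasing = AllPairs⇒Linked d ; positive = p ; total = eq }

partitions-unique : ∀ n → Unique (partitions n)
partitions-unique n = unique n n

{-# OPTIONS --safe #-}
module Submission where

-- A partition λ is a partition μ, each part taken twice, together with
-- the strict partition δ of its unpaired parts.  By removing the largest
-- part and the Pascal rules for Gaussian binomials, the pairs with largest
-- part r and at most 2c parts are generated by the complete homogeneous
-- polynomial h_r(q², q⁴, …, q^(2c)), and the strict partitions with
-- alternating sum s and u₁ - s < c by h_s(q, q³, …, q^(2c-1)).  Hence
-- those λ with T(λ) = a and W(λ) ≤ b are generated by
-- ∑_{r+s=a} h_r(q², q⁴, …) h_s(q, q³, …) = h_a(q, q², …, q^b), and those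
-- with W(λ) = b by the difference
-- h_a(q, …, q^b) - h_a(q, …, q^(b-1)) = q^b h_{a-1}(q, …, q^b).

open import Defs
open import Algebra.Bundles using (module AbelianGroup)
open import Data.Bool.Base using (true; false; if_then_else_)
open import Data.Integer.Base as ℤ using (ℤ; 0ℤ; 1ℤ)
import Data.Integer.Properties as ℤ
open import Data.Integer.Tactic.RingSolver using (solve-∀)
open import Data.List.Base
  using (List; []; _∷_; _++_; length; map; filter; replicate; upTo; concatMap)
open import Data.List.Extrema.Nat using (max; max≈v⁺)
open import Data.List.Properties
  using (map-applyUpTo; map-cong-local; filter-all; filter-none; filter-accept;
         filter-reject; filter-++)
open import Data.List.Relation.Unary.All as All using (All; []; _∷_)
import Data.List.Relation.Unary.All.Properties as All
open import Data.List.Relation.Unary.Any using (here)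
open import Data.Nat.Base
open import Data.Nat.DivMod using (_/_; _%_; m<n⇒m/n≡0; m/n≡1+[m∸n]/n)
open import Data.Nat.Induction using (<-rec)
open import Data.Nat.ListAction using (sum)
open import Data.Nat.Properties
open import Data.Product.Base using (∃; _×_; _,_; proj₁; proj₂)
open import Function.Base using (_∘_; id)
open import Level using (0ℓ)
open import Relation.Binary.PropositionalEquality
import Relation.Binary.Reasoning.Setoid as SetoidReasoning
open import Relation.Nullary using (Dec; yes; no; does; ¬_; contradiction; _×-dec_)
open import Relation.Nullary.Decidable using (¬?)
open import Relation.Unary using (Pred; Decidable)

import Algebra.Properties.Group (AbelianGroup.group ℤ.+-0-abelianGroup) as ℤ+

-- The width is first bounded and only then fixed, because a bound on a maximum is a conjunction:
-- `W ≤ b` bounds pairs and unpaired parts separately, so the generating function factors, which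
-- `W = b` does not allow. The two bounds fit together by parity. The pair span is even and a
-- nonzero residual span is odd, so bounding both by `b` admits exactly the even and the odd
-- exponents among 1, ..., b. The alternating sum becomes tractable because prefixing a part `u`
-- replaces the alternating sum `t` of the rest by `u - t`. Among strict partitions with parts at
-- most `m`, the part `m` therefore exchanges the sums `i` and `m - i`, and the Pascal rule in q²
-- together with the symmetry of Gaussian binomials absorbs this exchange. Once the alternating sum
-- is fixed, bounding the residual span is bounding the largest part. A technical obstacle is that
-- the partitions of `n` are listed with parts at most `n`, while identities of series need one
-- bound on the parts for all coefficients; `weigh-stable` mediates.

module ≗-Reasoning = SetoidReasoning (ℕ →-setoid ℤ)

-- Equality and addition of power series

≗-refl : {f : Series} → f ≗ f
≗-refl _ = refl

≗-sym : {f g : Series} → f ≗ g → g ≗ f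
≗-sym p n = sym (p n)

≗-trans : {f g h : Series} → f ≗ g → g ≗ h → f ≗ h
≗-trans p q n = trans (p n) (q n)

infixl 6 _+ˢ_

_+ˢ_ : Series → Series → Series
(f +ˢ g) n = f n ℤ.+ g n

+ˢ-cong : ∀ {f f′ g g′} → f ≗ f′ → g ≗ g′ → f +ˢ g ≗ f′ +ˢ g′
+ˢ-cong p q n = cong₂ ℤ._+_ (p n) (q n)

+ˢ-identityˡ : ∀ f → 0ˢ +ˢ f ≗ f
+ˢ-identityˡ f n = ℤ.+-identityˡ (f n)

+ˢ-identityʳ : ∀ f → f +ˢ 0ˢ ≗ f
+ˢ-identityʳ f n = ℤ.+-identityʳ (f n)

+ˢ-assoc : ∀ f g h → (f +ˢ g) +ˢ h ≗ f +ˢ (g +ˢ h)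
+ˢ-assoc f g h n = ℤ.+-assoc (f n) (g n) (h n)

+ˢ-interchange : ∀ f g h k → (f +ˢ g) +ˢ (h +ˢ k) ≗ (f +ˢ h) +ˢ (g +ˢ k)
+ˢ-interchange f g h k n = interchange (f n) (g n) (h n) (k n)
  where
  interchange : ∀ w x y z → (w ℤ.+ x) ℤ.+ (y ℤ.+ z) ≡ (w ℤ.+ y) ℤ.+ (x ℤ.+ z)
  interchange = solve-∀

-- Multiplication by a power of q

shift : ℕ → Series → Series
shift zero    f n       = f n
shift (suc k) f zero    = 0ℤ
shift (suc k) f (suc n) = shift k f n

shift-cong : ∀ k {f g} → f ≗ g → shift k f ≗ shift k g
shift-cong zero    p n       = p n
shift-cong (suc k) p zero    = refl
shift-cong (suc k) p (suc n) = shift-cong k p n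

shift-cong-< : ∀ k {f g} n → (∀ {j} → j < n → f j ≡ g j) →
               shift (suc k) f n ≡ shift (suc k) g n
shift-cong-< k       zero    p = refl
shift-cong-< zero    (suc n) p = p ≤-refl
shift-cong-< (suc k) (suc n) p = shift-cong-< k n (λ j<n → p (m<n⇒m<1+n j<n))

shift-< : ∀ k f {n} → n < k → shift k f n ≡ 0ℤ
shift-< (suc k) f {zero}  _       = refl
shift-< (suc k) f {suc n} (s≤s p) = shift-< k f p

shift-+ : ∀ k f n → shift k f (k + n) ≡ f n
shift-+ zero    f n = refl
shift-+ (suc k) f n = shift-+ k f n

shift-0ˢ : ∀ k → shift k 0ˢ ≗ 0ˢ
shift-0ˢ zero    n       = refl
shift-0ˢ (suc k) zero    = refl
shift-0ˢ (suc k) (suc n) = shift-0ˢ k n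

shift-+ˢ : ∀ k f g → shift k (f +ˢ g) ≗ shift k f +ˢ shift k g
shift-+ˢ zero    f g n       = refl
shift-+ˢ (suc k) f g zero    = refl
shift-+ˢ (suc k) f g (suc n) = shift-+ˢ k f g n

shift--ˢ : ∀ k f g → shift k (f -ˢ g) ≗ shift k f -ˢ shift k g
shift--ˢ zero    f g n       = refl
shift--ˢ (suc k) f g zero    = refl
shift--ˢ (suc k) f g (suc n) = shift--ˢ k f g n

shift-shift : ∀ j k f → shift j (shift k f) ≗ shift (j + k) f
shift-shift zero    k f n       = refl
shift-shift (suc j) k f zero    = refl
shift-shift (suc j) k f (suc n) = shift-shift j k f n

shift-exponent : ∀ {j k} f → j ≡ k → shift j f ≗ shift k f
shift-exponent f refl = ≗-refl

-- The substitution q ↦ q²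

double : ℕ → ℕ
double zero    = zero
double (suc n) = suc (suc (double n))

double≡+ : ∀ n → double n ≡ n + n
double≡+ zero    = refl
double≡+ (suc n) = cong suc (trans (cong suc (double≡+ n)) (sym (+-suc n n)))

dilate : Series → Series
dilate f zero          = f zero
dilate f (suc zero)    = 0ℤ
dilate f (suc (suc n)) = dilate (λ k → f (suc k)) n

dilate-cong : ∀ {f g} → f ≗ g → dilate f ≗ dilate g
dilate-cong p zero          = p zero
dilate-cong p (suc zero)    = refl
dilate-cong p (suc (suc n)) = dilate-cong (λ k → p (suc k)) n

dilate-0ˢ : dilate 0ˢ ≗ 0ˢ
dilate-0ˢ zero          = refl
dilate-0ˢ (suc zero)    = refl
dilate-0ˢ (suc (suc n)) = dilate-0ˢ n

dilate-1ˢ : dilate 1ˢ ≗ 1ˢ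
dilate-1ˢ zero          = refl
dilate-1ˢ (suc zero)    = refl
dilate-1ˢ (suc (suc n)) = dilate-0ˢ n

dilate-+ˢ : ∀ f g → dilate (f +ˢ g) ≗ dilate f +ˢ dilate g
dilate-+ˢ f g zero          = refl
dilate-+ˢ f g (suc zero)    = refl
dilate-+ˢ f g (suc (suc n)) = dilate-+ˢ (λ k → f (suc k)) (λ k → g (suc k)) n

dilate-shift : ∀ k f → dilate (shift k f) ≗ shift (double k) (dilate f)
dilate-shift zero    f n             = refl
dilate-shift (suc k) f zero          = refl
dilate-shift (suc k) f (suc zero)    = refl
dilate-shift (suc k) f (suc (suc n)) = dilate-shift k f n

-- Products of series

-- `(f *ˢ g) (suc n)` reduces to `f 0 * g (suc n)` plus coefficient `n` of the product of the tail
-- of `f` with `g`. The product laws below follow this recursion, with `f` replaced by its tail at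
-- each step.
*ˢ-cong : ∀ {f f′ g g′} → f ≗ f′ → g ≗ g′ → f *ˢ g ≗ f′ *ˢ g′
*ˢ-cong p q zero    = cong (ℤ._+ 0ℤ) (cong₂ ℤ._*_ (p 0) (q 0))
*ˢ-cong p q (suc n) =
  cong₂ ℤ._+_ (cong₂ ℤ._*_ (p 0) (q (suc n))) (*ˢ-cong (λ k → p (suc k)) q n)

*ˢ-zeroˡ : ∀ g → 0ˢ *ˢ g ≗ 0ˢ
*ˢ-zeroˡ g zero    = refl
*ˢ-zeroˡ g (suc n) = cong (ℤ._+_ 0ℤ) (*ˢ-zeroˡ g n)

*ˢ-zeroʳ : ∀ f → f *ˢ 0ˢ ≗ 0ˢ
*ˢ-zeroʳ f zero    = cong (ℤ._+ 0ℤ) (ℤ.*-zeroʳ (f 0))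
*ˢ-zeroʳ f (suc n) = cong₂ ℤ._+_ (ℤ.*-zeroʳ (f 0)) (*ˢ-zeroʳ (λ k → f (suc k)) n)

*ˢ-identityˡ : ∀ g → 1ˢ *ˢ g ≗ g
*ˢ-identityˡ g zero    = trans (ℤ.+-identityʳ _) (ℤ.*-identityˡ (g 0))
*ˢ-identityˡ g (suc n) = trans
  (cong₂ ℤ._+_ (ℤ.*-identityˡ (g (suc n))) (*ˢ-zeroˡ g n))
  (ℤ.+-identityʳ (g (suc n)))

*ˢ-identityʳ : ∀ f → f *ˢ 1ˢ ≗ f
*ˢ-identityʳ f zero    = trans (ℤ.+-identityʳ _) (ℤ.*-identityʳ (f 0))
*ˢ-identityʳ f (suc n) = trans
  (cong₂ ℤ._+_ (ℤ.*-zeroʳ (f 0)) (*ˢ-identityʳ (λ k → f (suc k)) n))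
  (ℤ.+-identityˡ (f (suc n)))

*ˢ-distribʳ-+ˢ : ∀ h f g → (f +ˢ g) *ˢ h ≗ f *ˢ h +ˢ g *ˢ h
*ˢ-distribʳ-+ˢ h f g zero    = lemma (f 0) (g 0) (h 0)
  where
  lemma : ∀ x y z → (x ℤ.+ y) ℤ.* z ℤ.+ 0ℤ ≡ (x ℤ.* z ℤ.+ 0ℤ) ℤ.+ (y ℤ.* z ℤ.+ 0ℤ)
  lemma = solve-∀
*ˢ-distribʳ-+ˢ h f g (suc n) = trans
  (cong (ℤ._+_ ((f 0 ℤ.+ g 0) ℤ.* h (suc n)))
        (*ˢ-distribʳ-+ˢ h (λ k → f (suc k)) (λ k → g (suc k)) n))
  (lemma (f 0) (g 0) (h (suc n)) _ _)
  where
  lemma : ∀ x y z v w → (x ℤ.+ y) ℤ.* z ℤ.+ (v ℤ.+ w) ≡ (x ℤ.* z ℤ.+ v) ℤ.+ (y ℤ.* z ℤ.+ w)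
  lemma = solve-∀

*ˢ-distribˡ-+ˢ : ∀ f g h → f *ˢ (g +ˢ h) ≗ f *ˢ g +ˢ f *ˢ h
*ˢ-distribˡ-+ˢ f g h zero    = lemma (f 0) (g 0) (h 0)
  where
  lemma : ∀ x y z → x ℤ.* (y ℤ.+ z) ℤ.+ 0ℤ ≡ (x ℤ.* y ℤ.+ 0ℤ) ℤ.+ (x ℤ.* z ℤ.+ 0ℤ)
  lemma = solve-∀
*ˢ-distribˡ-+ˢ f g h (suc n) = trans
  (cong (ℤ._+_ (f 0 ℤ.* (g (suc n) ℤ.+ h (suc n))))
        (*ˢ-distribˡ-+ˢ (λ k → f (suc k)) g h n))
  (lemma (f 0) (g (suc n)) (h (suc n)) _ _)
  where
  lemma : ∀ x y z v w → x ℤ.* (y ℤ.+ z) ℤ.+ (v ℤ.+ w) ≡ (x ℤ.* y ℤ.+ v) ℤ.+ (x ℤ.* z ℤ.+ w)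
  lemma = solve-∀

*ˢ-distribʳ--ˢ : ∀ h f g → (f -ˢ g) *ˢ h ≗ f *ˢ h -ˢ g *ˢ h
*ˢ-distribʳ--ˢ h f g zero    = lemma (f 0) (g 0) (h 0)
  where
  lemma : ∀ x y z → (x ℤ.- y) ℤ.* z ℤ.+ 0ℤ ≡ (x ℤ.* z ℤ.+ 0ℤ) ℤ.- (y ℤ.* z ℤ.+ 0ℤ)
  lemma = solve-∀
*ˢ-distribʳ--ˢ h f g (suc n) = trans
  (cong (ℤ._+_ ((f 0 ℤ.- g 0) ℤ.* h (suc n)))
        (*ˢ-distribʳ--ˢ h (λ k → f (suc k)) (λ k → g (suc k)) n))
  (lemma (f 0) (g 0) (h (suc n)) _ _)
  where
  lemma : ∀ x y z v w → (x ℤ.- y) ℤ.* z ℤ.+ (v ℤ.- w) ≡ (x ℤ.* z ℤ.+ v) ℤ.- (y ℤ.* z ℤ.+ w)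
  lemma = solve-∀

*ˢ-distribˡ--ˢ : ∀ f g h → f *ˢ (g -ˢ h) ≗ f *ˢ g -ˢ f *ˢ h
*ˢ-distribˡ--ˢ f g h zero    = lemma (f 0) (g 0) (h 0)
  where
  lemma : ∀ x y z → x ℤ.* (y ℤ.- z) ℤ.+ 0ℤ ≡ (x ℤ.* y ℤ.+ 0ℤ) ℤ.- (x ℤ.* z ℤ.+ 0ℤ)
  lemma = solve-∀
*ˢ-distribˡ--ˢ f g h (suc n) = trans
  (cong (ℤ._+_ (f 0 ℤ.* (g (suc n) ℤ.- h (suc n))))
        (*ˢ-distribˡ--ˢ (λ k → f (suc k)) g h n))
  (lemma (f 0) (g (suc n)) (h (suc n)) _ _)
  where
  lemma : ∀ x y z v w → x ℤ.* (y ℤ.- z) ℤ.+ (v ℤ.- w) ≡ (x ℤ.* y ℤ.+ v) ℤ.- (x ℤ.* z ℤ.+ w)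
  lemma = solve-∀

shift-*ˢ : ∀ k f g → shift k f *ˢ g ≗ shift k (f *ˢ g)
shift-*ˢ zero    f g n       = refl
shift-*ˢ (suc k) f g zero    = refl
shift-*ˢ (suc k) f g (suc n) = trans (ℤ.+-identityˡ _) (shift-*ˢ k f g n)

-- The product recursion consumes its first factor, so a shift of the second factor does not come
-- out by reduction; it is moved one power of q at a time.
*ˢ-shift₁ : ∀ f g → f *ˢ shift 1 g ≗ shift 1 (f *ˢ g)
*ˢ-shift₁ f g zero          = cong (ℤ._+ 0ℤ) (ℤ.*-zeroʳ (f 0))
*ˢ-shift₁ f g (suc zero)    = cong (ℤ._+_ (f 0 ℤ.* g 0)) (*ˢ-shift₁ (λ k → f (suc k)) g zero)
*ˢ-shift₁ f g (suc (suc n)) =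
  cong (ℤ._+_ (f 0 ℤ.* g (suc n))) (*ˢ-shift₁ (λ k → f (suc k)) g (suc n))

*ˢ-shift : ∀ k f g → f *ˢ shift k g ≗ shift k (f *ˢ g)
*ˢ-shift zero    f g = ≗-refl
*ˢ-shift (suc k) f g = begin
  f *ˢ shift (suc k) g      ≈⟨ *ˢ-cong (≗-refl {f}) (≗-sym (shift-shift 1 k g)) ⟩
  f *ˢ shift 1 (shift k g)  ≈⟨ *ˢ-shift₁ f (shift k g) ⟩
  shift 1 (f *ˢ shift k g)  ≈⟨ shift-cong 1 (*ˢ-shift k f g) ⟩
  shift 1 (shift k (f *ˢ g)) ≈⟨ shift-shift 1 k (f *ˢ g) ⟩
  shift (suc k) (f *ˢ g)    ∎
  where open ≗-Reasoning

q^≗shift : ∀ k → q^ k ≗ shift k 1ˢ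
q^≗shift zero    n       = refl
q^≗shift (suc k) zero    = refl
q^≗shift (suc k) (suc n) = q^≗shift k n

-- As `h` has constant term 1, the constant terms of `f` and `g` agree. Removing their equal
-- contributions leaves the same hypothesis for the tails.
*ˢ-cancelʳ : ∀ h → h 0 ≡ 1ℤ → ∀ f g → f *ˢ h ≗ g *ˢ h → f ≗ g
*ˢ-cancelʳ h h₀ f g p n = go n f g p
  where
  head-≡ : ∀ f g → f *ˢ h ≗ g *ˢ h → f 0 ≡ g 0
  head-≡ f g p = begin
    f 0                  ≡⟨ coefficient f ⟨
    (f *ˢ h) 0           ≡⟨ p 0 ⟩
    (g *ˢ h) 0           ≡⟨ coefficient g ⟩
    g 0                  ∎
    where
    open ≡-Reasoning
    coefficient : ∀ f → (f *ˢ h) 0 ≡ f 0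
    coefficient f rewrite h₀ = trans (ℤ.+-identityʳ _) (ℤ.*-identityʳ (f 0))

  go : ∀ n f g → f *ˢ h ≗ g *ˢ h → f n ≡ g n
  go zero    f g p = head-≡ f g p
  go (suc n) f g p = go n (λ k → f (suc k)) (λ k → g (suc k)) λ m →
    ℤ+.∙-cancelˡ (f 0 ℤ.* h (suc m)) _ _
      (trans (p (suc m))
             (cong (λ x → x ℤ.* h (suc m) ℤ.+ _) (sym (head-≡ f g p))))

-- The Pascal rules for Gaussian binomials

-- The Gaussian binomial [i+c choose i], generating partitions inside an
-- i × c box.
gauss : ℕ → ℕ → Series
gauss zero    c       = 1ˢ
gauss (suc i) zero    = 1ˢ
gauss (suc i) (suc c) = gauss (suc i) c +ˢ shift (suc c) (gauss i (suc c))

gauss-zeroʳ : ∀ i → gauss i 0 ≗ 1ˢ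
gauss-zeroʳ zero    = ≗-refl
gauss-zeroʳ (suc i) = ≗-refl

-- This is the conjugate of the rule that defines `gauss`. Both summands are expanded by induction,
-- and the definition reassembles two of the four terms. The doubly shifted term carries the
-- exponent `i + c + 3`, which is symmetric in `i` and `c`, so it can be regrouped with the
-- remaining one.
gauss-pascal′ : ∀ i c →
  gauss (suc i) (suc c) ≗ gauss i (suc c) +ˢ shift (suc i) (gauss (suc i) c)
gauss-pascal′ zero    zero    = ≗-refl
gauss-pascal′ zero    (suc c) = begin
  gauss 1 (suc c) +ˢ shift (2 + c) 1ˢ
    ≈⟨ +ˢ-cong (gauss-pascal′ 0 c) (≗-sym (shift-shift 1 (suc c) 1ˢ)) ⟩
  (1ˢ +ˢ shift 1 (gauss 1 c)) +ˢ shift 1 (shift (suc c) 1ˢ)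
    ≈⟨ +ˢ-assoc 1ˢ (shift 1 (gauss 1 c)) (shift 1 (shift (suc c) 1ˢ)) ⟩
  1ˢ +ˢ (shift 1 (gauss 1 c) +ˢ shift 1 (shift (suc c) 1ˢ))
    ≈⟨ +ˢ-cong (≗-refl {1ˢ}) (shift-+ˢ 1 (gauss 1 c) (shift (suc c) 1ˢ)) ⟨
  1ˢ +ˢ shift 1 (gauss 1 (suc c)) ∎
  where open ≗-Reasoning
gauss-pascal′ (suc i) zero    = begin
  1ˢ +ˢ shift 1 (gauss (suc i) 1)
    ≈⟨ +ˢ-cong (≗-refl {1ˢ}) (shift-cong 1 (gauss-pascal′ i 0)) ⟩
  1ˢ +ˢ shift 1 (gauss i 1 +ˢ shift (suc i) 1ˢ)
    ≈⟨ +ˢ-cong (≗-refl {1ˢ}) (shift-+ˢ 1 (gauss i 1) (shift (suc i) 1ˢ)) ⟩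
  1ˢ +ˢ (shift 1 (gauss i 1) +ˢ shift 1 (shift (suc i) 1ˢ))
    ≈⟨ +ˢ-assoc 1ˢ (shift 1 (gauss i 1)) (shift 1 (shift (suc i) 1ˢ)) ⟨
  gauss (suc i) 1 +ˢ shift 1 (shift (suc i) 1ˢ)
    ≈⟨ +ˢ-cong (≗-refl {gauss (suc i) 1}) (shift-shift 1 (suc i) 1ˢ) ⟩
  gauss (suc i) 1 +ˢ shift (2 + i) 1ˢ ∎
  where open ≗-Reasoning
gauss-pascal′ (suc i) (suc c) = begin
  gauss (2 + i) (suc c) +ˢ shift (2 + c) (gauss (suc i) (2 + c))
    ≈⟨ +ˢ-cong (gauss-pascal′ (suc i) c) (shift-cong (2 + c) (gauss-pascal′ i (suc c))) ⟩
  (A +ˢ shift (2 + i) B) +ˢ shift (2 + c) (C +ˢ shift (suc i) A)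
    ≈⟨ +ˢ-cong (≗-refl {A +ˢ shift (2 + i) B}) (shift-+ˢ (2 + c) C (shift (suc i) A)) ⟩
  (A +ˢ shift (2 + i) B) +ˢ (shift (2 + c) C +ˢ shift (2 + c) (shift (suc i) A))
    ≈⟨ +ˢ-interchange A (shift (2 + i) B) (shift (2 + c) C) (shift (2 + c) (shift (suc i) A)) ⟩
  gauss (suc i) (2 + c) +ˢ (shift (2 + i) B +ˢ shift (2 + c) (shift (suc i) A))
    ≈⟨ +ˢ-cong (≗-refl {gauss (suc i) (2 + c)}) (+ˢ-cong (≗-refl {shift (2 + i) B}) swap) ⟩
  gauss (suc i) (2 + c) +ˢ (shift (2 + i) B +ˢ shift (2 + i) (shift (suc c) A))
    ≈⟨ +ˢ-cong (≗-refl {gauss (suc i) (2 + c)}) (shift-+ˢ (2 + i) B (shift (suc c) A)) ⟨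
  gauss (suc i) (2 + c) +ˢ shift (2 + i) (gauss (2 + i) (suc c)) ∎
  where
  open ≗-Reasoning
  A = gauss (suc i) (suc c)
  B = gauss (2 + i) c
  C = gauss i (2 + c)
  swap : shift (2 + c) (shift (suc i) A) ≗ shift (2 + i) (shift (suc c) A)
  swap = begin
    shift (2 + c) (shift (suc i) A) ≈⟨ shift-shift (2 + c) (suc i) A ⟩
    shift (2 + c + suc i) A         ≈⟨ shift-exponent A exponents ⟩
    shift (2 + i + suc c) A         ≈⟨ shift-shift (2 + i) (suc c) A ⟨
    shift (2 + i) (shift (suc c) A) ∎
    where
    exponents : 2 + c + suc i ≡ 2 + i + suc c
    exponents = cong suc (+-comm (suc c) (suc i))

-- Swapping `i` and `c` exchanges the two Pascal rules. `strict-alt` relies on this symmetry, since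
-- removing the largest part exchanges the two indices.
gauss-comm : ∀ i c → gauss i c ≗ gauss c i
gauss-comm zero    c       = ≗-sym (gauss-zeroʳ c)
gauss-comm (suc i) zero    = ≗-refl
gauss-comm (suc i) (suc c) = ≗-trans
  (+ˢ-cong (gauss-comm (suc i) c) (shift-cong (suc c) (gauss-comm i (suc c))))
  (≗-sym (gauss-pascal′ c i))

-- The product formula for Gaussian binomials

-- Multiplication by `1 - q^k`, written as an operator that passes out of either factor of a
-- product.
Δ : ℕ → Series → Series
Δ k f = f -ˢ shift k f

Δ-cong : ∀ k {f g} → f ≗ g → Δ k f ≗ Δ k g
Δ-cong k p n = cong₂ ℤ._-_ (p n) (shift-cong k p n)

Δ-*ˢ : ∀ k f g → Δ k f *ˢ g ≗ Δ k (f *ˢ g)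
Δ-*ˢ k f g n = trans (*ˢ-distribʳ--ˢ g f (shift k f) n)
                     (cong (ℤ._-_ ((f *ˢ g) n)) (shift-*ˢ k f g n))

*ˢ-Δ : ∀ k f g → f *ˢ Δ k g ≗ Δ k (f *ˢ g)
*ˢ-Δ k f g n = trans (*ˢ-distribˡ--ˢ f g (shift k g) n)
                     (cong (ℤ._-_ ((f *ˢ g) n)) (*ˢ-shift k f g n))

qPochhammer-suc : ∀ N → qPochhammer (suc N) ≗ Δ (suc N) (qPochhammer N)
qPochhammer-suc N = begin
  P *ˢ (1ˢ -ˢ q^ suc N)       ≈⟨ *ˢ-cong (≗-refl {P})
                                         (λ n → cong (ℤ._-_ (1ˢ n)) (q^≗shift (suc N) n)) ⟩
  P *ˢ Δ (suc N) 1ˢ           ≈⟨ *ˢ-Δ (suc N) P 1ˢ ⟩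
  Δ (suc N) (P *ˢ 1ˢ)         ≈⟨ Δ-cong (suc N) (*ˢ-identityʳ P) ⟩
  Δ (suc N) P                 ∎
  where
  open ≗-Reasoning
  P = qPochhammer N

-- Taking the last factor out of one Pochhammer symbol turns each Pascal term into an instance of
-- the induction hypothesis. With `R` the symbol of index `i + j + 1`, the terms are
-- `(1 - q^(j+1)) R` and `q^(j+1) (1 - q^(i+1)) R`, and their sum telescopes to `(1 - q^(i+j+2)) R`.
gauss-*ˢ-qPochhammer : ∀ i j →
  gauss i j *ˢ (qPochhammer i *ˢ qPochhammer j) ≗ qPochhammer (i + j)
gauss-*ˢ-qPochhammer zero    j = begin
  1ˢ *ˢ (1ˢ *ˢ qPochhammer j) ≈⟨ *ˢ-identityˡ (1ˢ *ˢ qPochhammer j) ⟩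
  1ˢ *ˢ qPochhammer j         ≈⟨ *ˢ-identityˡ (qPochhammer j) ⟩
  qPochhammer j               ∎
  where open ≗-Reasoning
gauss-*ˢ-qPochhammer (suc i) zero = begin
  1ˢ *ˢ (qPochhammer (suc i) *ˢ 1ˢ) ≈⟨ *ˢ-identityˡ (qPochhammer (suc i) *ˢ 1ˢ) ⟩
  qPochhammer (suc i) *ˢ 1ˢ         ≈⟨ *ˢ-identityʳ (qPochhammer (suc i)) ⟩
  qPochhammer (suc i)               ≡⟨ cong qPochhammer (+-identityʳ (suc i)) ⟨
  qPochhammer (suc i + 0)           ∎
  where open ≗-Reasoning
gauss-*ˢ-qPochhammer (suc i) (suc j) = begin
  gauss (suc i) (suc j) *ˢ Z
    ≈⟨ *ˢ-distribʳ-+ˢ Z (gauss (suc i) j) (shift (suc j) (gauss i (suc j))) ⟩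
  gauss (suc i) j *ˢ Z +ˢ shift (suc j) (gauss i (suc j)) *ˢ Z
    ≈⟨ +ˢ-cong first second ⟩
  Δ (suc j) R +ˢ shift (suc j) (Δ (suc i) R)
    ≈⟨ +ˢ-cong (≗-refl {Δ (suc j) R}) (shift--ˢ (suc j) R (shift (suc i) R)) ⟩
  Δ (suc j) R +ˢ (shift (suc j) R -ˢ shift (suc j) (shift (suc i) R))
    ≈⟨ (λ n → telescope (R n) (shift (suc j) R n) (shift (suc j) (shift (suc i) R) n)) ⟩
  R -ˢ shift (suc j) (shift (suc i) R)
    ≈⟨ (λ n → cong (ℤ._-_ (R n)) (shift-shift (suc j) (suc i) R n)) ⟩
  Δ (suc j + suc i) R
    ≡⟨ cong (λ k → Δ k R) (+-comm (suc j) (suc i)) ⟩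
  Δ (suc (i + suc j)) (qPochhammer (i + suc j))
    ≈⟨ qPochhammer-suc (i + suc j) ⟨
  qPochhammer (suc i + suc j) ∎
  where
  open ≗-Reasoning
  R = qPochhammer (i + suc j)
  Z = qPochhammer (suc i) *ˢ qPochhammer (suc j)
  telescope : ∀ x y z → (x ℤ.- y) ℤ.+ (y ℤ.- z) ≡ x ℤ.- z
  telescope = solve-∀
  first : gauss (suc i) j *ˢ Z ≗ Δ (suc j) R
  first = begin
    gauss (suc i) j *ˢ Z
      ≈⟨ *ˢ-cong (≗-refl {gauss (suc i) j})
           (≗-trans (*ˢ-cong (≗-refl {qPochhammer (suc i)}) (qPochhammer-suc j))
                    (*ˢ-Δ (suc j) (qPochhammer (suc i)) (qPochhammer j))) ⟩
    gauss (suc i) j *ˢ Δ (suc j) (qPochhammer (suc i) *ˢ qPochhammer j)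
      ≈⟨ *ˢ-Δ (suc j) (gauss (suc i) j) (qPochhammer (suc i) *ˢ qPochhammer j) ⟩
    Δ (suc j) (gauss (suc i) j *ˢ (qPochhammer (suc i) *ˢ qPochhammer j))
      ≈⟨ Δ-cong (suc j) (gauss-*ˢ-qPochhammer (suc i) j) ⟩
    Δ (suc j) (qPochhammer (suc i + j))
      ≡⟨ cong (λ k → Δ (suc j) (qPochhammer k)) (+-suc i j) ⟨
    Δ (suc j) R ∎
  second : shift (suc j) (gauss i (suc j)) *ˢ Z ≗ shift (suc j) (Δ (suc i) R)
  second = begin
    shift (suc j) (gauss i (suc j)) *ˢ Z
      ≈⟨ shift-*ˢ (suc j) (gauss i (suc j)) Z ⟩
    shift (suc j) (gauss i (suc j) *ˢ Z)
      ≈⟨ shift-cong (suc j) (*ˢ-cong (≗-refl {gauss i (suc j)})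
           (≗-trans (*ˢ-cong (qPochhammer-suc i) (≗-refl {qPochhammer (suc j)}))
                    (Δ-*ˢ (suc i) (qPochhammer i) (qPochhammer (suc j))))) ⟩
    shift (suc j) (gauss i (suc j) *ˢ Δ (suc i) (qPochhammer i *ˢ qPochhammer (suc j)))
      ≈⟨ shift-cong (suc j)
           (*ˢ-Δ (suc i) (gauss i (suc j)) (qPochhammer i *ˢ qPochhammer (suc j))) ⟩
    shift (suc j) (Δ (suc i) (gauss i (suc j) *ˢ (qPochhammer i *ˢ qPochhammer (suc j))))
      ≈⟨ shift-cong (suc j) (Δ-cong (suc i) (gauss-*ˢ-qPochhammer i (suc j))) ⟩
    shift (suc j) (Δ (suc i) R) ∎

gaussianBinomial≗gauss : ∀ i j → gaussianBinomial (i + j) i ≗ gauss i j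
gaussianBinomial≗gauss i j = *ˢ-cancelʳ (qPochhammer i *ˢ qPochhammer j)
  (*ˢ-constant (qPochhammer i) (qPochhammer j)
               (qPochhammer-constant i) (qPochhammer-constant j))
  (gaussianBinomial (i + j) i) (gauss i j)
  (≗-trans
    (subst (λ k → gaussianBinomial (i + j) i *ˢ (qPochhammer i *ˢ qPochhammer k)
                  ≗ qPochhammer (i + j))
           (m+n∸m≡n i j) (gaussianBinomial-* (m≤m+n i j)))
    (≗-sym (gauss-*ˢ-qPochhammer i j)))

-- Complete homogeneous symmetric polynomials in powers of q

-- h_k(q, q², …, q^c)
homogeneous : ℕ → ℕ → Series
homogeneous k       (suc c) = shift k (gauss k c)
homogeneous zero    zero    = 1ˢ
homogeneous (suc k) zero    = 0ˢ

-- h_k(q², q⁴, …, q^(2c))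
evenHomogeneous : ℕ → ℕ → Series
evenHomogeneous k c = dilate (homogeneous k c)

-- h_k(q, q³, …, q^(2c-1))
oddHomogeneous : ℕ → ℕ → Series
oddHomogeneous k       (suc c) = shift k (dilate (gauss k c))
oddHomogeneous zero    zero    = 1ˢ
oddHomogeneous (suc k) zero    = 0ˢ

homogeneous-zero : ∀ c → homogeneous 0 c ≗ 1ˢ
homogeneous-zero zero    = ≗-refl
homogeneous-zero (suc c) = ≗-refl

evenHomogeneous-zero : ∀ c → evenHomogeneous 0 c ≗ 1ˢ
evenHomogeneous-zero c = ≗-trans (dilate-cong (homogeneous-zero c)) dilate-1ˢ

oddHomogeneous-zero : ∀ c → oddHomogeneous 0 c ≗ 1ˢ
oddHomogeneous-zero zero    = ≗-refl
oddHomogeneous-zero (suc c) = dilate-1ˢ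

-- A monomial either avoids the last variable `q^(c+1)` or contains a factor of it. On the Gaussian
-- binomials this is the Pascal rule that defines `gauss`, multiplied by `q^(k+1)`.
homogeneous-suc : ∀ k c →
  homogeneous (suc k) (suc c) ≗
  homogeneous (suc k) c +ˢ shift (suc c) (homogeneous k (suc c))
homogeneous-suc k zero = begin
  shift (suc k) 1ˢ                        ≈⟨ shift-shift 1 k 1ˢ ⟨
  shift 1 (shift k 1ˢ)                    ≈⟨ shift-cong 1 (shift-cong k (gauss-zeroʳ k)) ⟨
  shift 1 (shift k (gauss k 0))           ≈⟨ +ˢ-identityˡ (shift 1 (shift k (gauss k 0))) ⟨
  0ˢ +ˢ shift 1 (shift k (gauss k 0))     ∎
  where open ≗-Reasoning
homogeneous-suc k (suc c) = begin
  shift (suc k) (gauss (suc k) c +ˢ shift (suc c) G)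
    ≈⟨ shift-+ˢ (suc k) (gauss (suc k) c) (shift (suc c) G) ⟩
  shift (suc k) (gauss (suc k) c) +ˢ shift (suc k) (shift (suc c) G)
    ≈⟨ +ˢ-cong (≗-refl {shift (suc k) (gauss (suc k) c)}) swap ⟩
  shift (suc k) (gauss (suc k) c) +ˢ shift (2 + c) (shift k G) ∎
  where
  open ≗-Reasoning
  G = gauss k (suc c)
  swap : shift (suc k) (shift (suc c) G) ≗ shift (2 + c) (shift k G)
  swap = begin
    shift (suc k) (shift (suc c) G) ≈⟨ shift-shift (suc k) (suc c) G ⟩
    shift (suc k + suc c) G         ≡⟨ cong (λ e → shift (suc e) G) (+-comm k (suc c)) ⟩
    shift (2 + c + k) G             ≈⟨ shift-shift (2 + c) k G ⟨
    shift (2 + c) (shift k G)       ∎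

evenHomogeneous-suc : ∀ k c →
  evenHomogeneous (suc k) (suc c) ≗
  evenHomogeneous (suc k) c +ˢ shift (double (suc c)) (evenHomogeneous k (suc c))
evenHomogeneous-suc k c = begin
  dilate (homogeneous (suc k) (suc c))
    ≈⟨ dilate-cong (homogeneous-suc k c) ⟩
  dilate (homogeneous (suc k) c +ˢ shift (suc c) (homogeneous k (suc c)))
    ≈⟨ dilate-+ˢ (homogeneous (suc k) c) (shift (suc c) (homogeneous k (suc c))) ⟩
  evenHomogeneous (suc k) c +ˢ dilate (shift (suc c) (homogeneous k (suc c)))
    ≈⟨ +ˢ-cong (≗-refl {evenHomogeneous (suc k) c})
               (dilate-shift (suc c) (homogeneous k (suc c))) ⟩
  evenHomogeneous (suc k) c +ˢ shift (double (suc c)) (evenHomogeneous k (suc c)) ∎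
  where open ≗-Reasoning

-- Since `q^(2j-1) = q^(-1) q^(2j)`, homogeneity makes h_k of the odd powers `q^(-k)` times h_k of
-- the even powers. This is why `shift k` stands outside `dilate` in `oddHomogeneous`, and why the
-- adjoined variable is `q^(2c+1)`.
oddHomogeneous-suc : ∀ k c →
  oddHomogeneous (suc k) (suc c) ≗
  oddHomogeneous (suc k) c +ˢ shift (suc (double c)) (oddHomogeneous k (suc c))
oddHomogeneous-suc k zero = begin
  shift (suc k) (dilate 1ˢ)                    ≈⟨ shift-shift 1 k (dilate 1ˢ) ⟨
  shift 1 (shift k (dilate 1ˢ))                ≈⟨ shift-cong 1 (shift-cong k (dilate-cong (gauss-zeroʳ k))) ⟨
  shift 1 (shift k (dilate (gauss k 0)))       ≈⟨ +ˢ-identityˡ (shift 1 (shift k (dilate (gauss k 0)))) ⟨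
  0ˢ +ˢ shift 1 (shift k (dilate (gauss k 0))) ∎
  where open ≗-Reasoning
oddHomogeneous-suc k (suc c) = begin
  shift (suc k) (dilate (gauss (suc k) c +ˢ shift (suc c) (gauss k (suc c))))
    ≈⟨ shift-cong (suc k) (dilate-+ˢ (gauss (suc k) c) (shift (suc c) (gauss k (suc c)))) ⟩
  shift (suc k) (dilate (gauss (suc k) c) +ˢ dilate (shift (suc c) (gauss k (suc c))))
    ≈⟨ shift-+ˢ (suc k) (dilate (gauss (suc k) c)) (dilate (shift (suc c) (gauss k (suc c)))) ⟩
  H +ˢ shift (suc k) (dilate (shift (suc c) (gauss k (suc c))))
    ≈⟨ +ˢ-cong (≗-refl {H}) (shift-cong (suc k) (dilate-shift (suc c) (gauss k (suc c)))) ⟩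
  H +ˢ shift (suc k) (shift (double (suc c)) G)
    ≈⟨ +ˢ-cong (≗-refl {H}) swap ⟩
  H +ˢ shift (suc (double (suc c))) (shift k G) ∎
  where
  open ≗-Reasoning
  G = dilate (gauss k (suc c))
  H = shift (suc k) (dilate (gauss (suc k) c))
  swap : shift (suc k) (shift (double (suc c)) G) ≗ shift (suc (double (suc c))) (shift k G)
  swap = begin
    shift (suc k) (shift (double (suc c)) G) ≈⟨ shift-shift (suc k) (double (suc c)) G ⟩
    shift (suc k + double (suc c)) G         ≡⟨ cong (λ e → shift (suc e) G) (+-comm k (double (suc c))) ⟩
    shift (suc (double (suc c)) + k) G       ≈⟨ shift-shift (suc (double (suc c))) k G ⟨
    shift (suc (double (suc c))) (shift k G) ∎

-- The coefficient of z^a in (∑ E_r z^r)(∑ O_s z^s)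
convolve : (ℕ → Series) → (ℕ → Series) → ℕ → Series
convolve E O zero    = E 0 *ˢ O 0
convolve E O (suc a) = E 0 *ˢ O (suc a) +ˢ convolve (λ r → E (suc r)) O a

convolve-congˡ : ∀ {E E′} O a → (∀ r → E r ≗ E′ r) → convolve E O a ≗ convolve E′ O a
convolve-congˡ O zero    p = *ˢ-cong (p 0) ≗-refl
convolve-congˡ O (suc a) p =
  +ˢ-cong (*ˢ-cong (p 0) ≗-refl) (convolve-congˡ O a (λ r → p (suc r)))

convolve-zeroˡ : ∀ {E} O a → (∀ r → E r ≗ 0ˢ) → convolve E O a ≗ 0ˢ
convolve-zeroˡ O zero    p = ≗-trans (*ˢ-cong (p 0) ≗-refl) (*ˢ-zeroˡ (O 0))
convolve-zeroˡ O (suc a) p = ≗-trans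
  (+ˢ-cong (≗-trans (*ˢ-cong (p 0) ≗-refl) (*ˢ-zeroˡ (O (suc a))))
           (convolve-zeroˡ O a (λ r → p (suc r))))
  (+ˢ-identityˡ 0ˢ)

convolve-+ˢ : ∀ E E′ O a →
  convolve (λ r → E r +ˢ E′ r) O a ≗ convolve E O a +ˢ convolve E′ O a
convolve-+ˢ E E′ O zero    = *ˢ-distribʳ-+ˢ (O 0) (E 0) (E′ 0)
convolve-+ˢ E E′ O (suc a) = ≗-trans
  (+ˢ-cong (*ˢ-distribʳ-+ˢ (O (suc a)) (E 0) (E′ 0))
           (convolve-+ˢ (λ r → E (suc r)) (λ r → E′ (suc r)) O a))
  (+ˢ-interchange (E 0 *ˢ O (suc a)) (E′ 0 *ˢ O (suc a)) _ _)

convolve-shift : ∀ w E O a →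
  convolve (λ r → shift w (E r)) O a ≗ shift w (convolve E O a)
convolve-shift w E O zero    = shift-*ˢ w (E 0) (O 0)
convolve-shift w E O (suc a) = ≗-trans
  (+ˢ-cong (shift-*ˢ w (E 0) (O (suc a))) (convolve-shift w (λ r → E (suc r)) O a))
  (≗-sym (shift-+ˢ w (E 0 *ˢ O (suc a)) (convolve (λ r → E (suc r)) O a)))

-- Adjoining a variable q^w to one of the two families of complete
-- homogeneous polynomials adjoins it to their convolution.
module _ (w : ℕ) where

  convolve-adjoinˡ : ∀ E E′ O → E′ 0 ≗ E 0 →
    (∀ r → E′ (suc r) ≗ E (suc r) +ˢ shift w (E′ r)) → ∀ a →
    convolve E′ O (suc a) ≗ convolve E O (suc a) +ˢ shift w (convolve E′ O a)
  convolve-adjoinˡ E E′ O p₀ p a = begin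
    E′ 0 *ˢ O (suc a) +ˢ convolve (λ r → E′ (suc r)) O a
      ≈⟨ +ˢ-cong (*ˢ-cong p₀ ≗-refl) (convolve-congˡ O a p) ⟩
    E 0 *ˢ O (suc a) +ˢ convolve (λ r → E (suc r) +ˢ shift w (E′ r)) O a
      ≈⟨ +ˢ-cong (≗-refl {E 0 *ˢ O (suc a)})
           (≗-trans (convolve-+ˢ (λ r → E (suc r)) (λ r → shift w (E′ r)) O a)
                    (+ˢ-cong (≗-refl {convolve (λ r → E (suc r)) O a})
                             (convolve-shift w E′ O a))) ⟩
    E 0 *ˢ O (suc a) +ˢ (convolve (λ r → E (suc r)) O a +ˢ shift w (convolve E′ O a))
      ≈⟨ +ˢ-assoc (E 0 *ˢ O (suc a)) (convolve (λ r → E (suc r)) O a)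
                  (shift w (convolve E′ O a)) ⟨
    convolve E O (suc a) +ˢ shift w (convolve E′ O a) ∎
    where open ≗-Reasoning

  -- For the series in z the hypotheses say `(1 - q^w z) O′(z) = O(z)`. `convolve` recurses on its
  -- first family, so `p` is applied to the leading term and the remainder is handled by induction
  -- with `E` moved up by one; `p₀` serves the last term, where the index of `O′` has dropped to 0.
  convolve-adjoinʳ : ∀ E O O′ → O′ 0 ≗ O 0 →
    (∀ s → O′ (suc s) ≗ O (suc s) +ˢ shift w (O′ s)) → ∀ a →
    convolve E O′ (suc a) ≗ convolve E O (suc a) +ˢ shift w (convolve E O′ a)
  convolve-adjoinʳ E O O′ p₀ p a = begin
    E 0 *ˢ O′ (suc a) +ˢ convolve E⁺ O′ a
      ≈⟨ +ˢ-cong (≗-trans (*ˢ-cong (≗-refl {E 0}) (p a))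
                          (≗-trans (*ˢ-distribˡ-+ˢ (E 0) (O (suc a)) (shift w (O′ a)))
                                   (+ˢ-cong (≗-refl {E 0 *ˢ O (suc a)}) (*ˢ-shift w (E 0) (O′ a)))))
                 (≗-refl {convolve E⁺ O′ a}) ⟩
    (E 0 *ˢ O (suc a) +ˢ shift w (E 0 *ˢ O′ a)) +ˢ convolve E⁺ O′ a
      ≈⟨ tail a ⟩
    convolve E O (suc a) +ˢ shift w (convolve E O′ a) ∎
    where
    open ≗-Reasoning
    E⁺ : ℕ → Series
    E⁺ r = E (suc r)
    tail : ∀ a → (E 0 *ˢ O (suc a) +ˢ shift w (E 0 *ˢ O′ a)) +ˢ convolve E⁺ O′ a
                 ≗ convolve E O (suc a) +ˢ shift w (convolve E O′ a)
    tail zero n = trans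
      (cong (λ x → ((E 0 *ˢ O 1) n ℤ.+ shift w (E 0 *ˢ O′ 0) n) ℤ.+ x) (*ˢ-cong (≗-refl {E 1}) p₀ n))
      (rearrange ((E 0 *ˢ O 1) n) (shift w (E 0 *ˢ O′ 0) n) ((E 1 *ˢ O 0) n))
      where
      rearrange : ∀ x y z → (x ℤ.+ y) ℤ.+ z ≡ (x ℤ.+ z) ℤ.+ y
      rearrange = solve-∀
    tail (suc a) = begin
      (E 0 *ˢ O (2 + a) +ˢ shift w (E 0 *ˢ O′ (suc a))) +ˢ convolve E⁺ O′ (suc a)
        ≈⟨ +ˢ-cong (≗-refl {E 0 *ˢ O (2 + a) +ˢ shift w (E 0 *ˢ O′ (suc a))})
                   (convolve-adjoinʳ E⁺ O O′ p₀ p a) ⟩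
      (E 0 *ˢ O (2 + a) +ˢ shift w (E 0 *ˢ O′ (suc a)))
        +ˢ (convolve E⁺ O (suc a) +ˢ shift w (convolve E⁺ O′ a))
        ≈⟨ +ˢ-interchange (E 0 *ˢ O (2 + a)) (shift w (E 0 *ˢ O′ (suc a)))
             (convolve E⁺ O (suc a)) (shift w (convolve E⁺ O′ a)) ⟩
      convolve E O (2 + a)
        +ˢ (shift w (E 0 *ˢ O′ (suc a)) +ˢ shift w (convolve E⁺ O′ a))
        ≈⟨ +ˢ-cong (≗-refl {convolve E O (2 + a)})
                   (shift-+ˢ w (E 0 *ˢ O′ (suc a)) (convolve E⁺ O′ a)) ⟨
      convolve E O (2 + a) +ˢ shift w (convolve E O′ (suc a)) ∎

evens odds : ℕ → ℕ → Series
evens c k = evenHomogeneous k c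
odds  c k = oddHomogeneous k c

-- The even and the odd powers of q up to q^b together are all of them.
mutual
  convolve-evens-odds : ∀ c a → convolve (evens c) (odds c) a ≗ homogeneous a (double c)
  convolve-evens-odds zero    zero    = ≗-trans (*ˢ-cong dilate-1ˢ (≗-refl {1ˢ})) (*ˢ-identityˡ 1ˢ)
  convolve-evens-odds zero    (suc a) = ≗-trans
    (+ˢ-cong (*ˢ-zeroʳ (evens 0 0)) (convolve-zeroˡ (odds 0) a (λ _ → dilate-0ˢ)))
    (+ˢ-identityˡ 0ˢ)
  convolve-evens-odds (suc c) zero    = ≗-trans
    (*ˢ-cong (evenHomogeneous-zero (suc c)) (oddHomogeneous-zero (suc c))) (*ˢ-identityˡ 1ˢ)
  convolve-evens-odds (suc c) (suc a) = begin
    convolve (evens (suc c)) (odds (suc c)) (suc a)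
      ≈⟨ convolve-adjoinˡ (double (suc c)) (evens c) (evens (suc c)) (odds (suc c))
           (≗-trans (evenHomogeneous-zero (suc c)) (≗-sym (evenHomogeneous-zero c)))
           (λ r → evenHomogeneous-suc r c) a ⟩
    convolve (evens c) (odds (suc c)) (suc a)
      +ˢ shift (double (suc c)) (convolve (evens (suc c)) (odds (suc c)) a)
      ≈⟨ +ˢ-cong (convolve-evens-odds⁺ c (suc a))
                 (shift-cong (double (suc c)) (convolve-evens-odds (suc c) a)) ⟩
    homogeneous (suc a) (suc (double c))
      +ˢ shift (double (suc c)) (homogeneous a (double (suc c)))
      ≈⟨ homogeneous-suc a (suc (double c)) ⟨
    homogeneous (suc a) (double (suc c)) ∎
    where open ≗-Reasoning

  convolve-evens-odds⁺ : ∀ c a →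
    convolve (evens c) (odds (suc c)) a ≗ homogeneous a (suc (double c))
  convolve-evens-odds⁺ c zero    = ≗-trans
    (*ˢ-cong (evenHomogeneous-zero c) (oddHomogeneous-zero (suc c))) (*ˢ-identityˡ 1ˢ)
  convolve-evens-odds⁺ c (suc a) = begin
    convolve (evens c) (odds (suc c)) (suc a)
      ≈⟨ convolve-adjoinʳ (suc (double c)) (evens c) (odds c) (odds (suc c))
           (≗-trans (oddHomogeneous-zero (suc c)) (≗-sym (oddHomogeneous-zero c)))
           (λ s → oddHomogeneous-suc s c) a ⟩
    convolve (evens c) (odds c) (suc a)
      +ˢ shift (suc (double c)) (convolve (evens c) (odds (suc c)) a)
      ≈⟨ +ˢ-cong (convolve-evens-odds c (suc a))
                 (shift-cong (suc (double c)) (convolve-evens-odds⁺ c a)) ⟩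
    homogeneous (suc a) (double c)
      +ˢ shift (suc (double c)) (homogeneous a (suc (double c)))
      ≈⟨ homogeneous-suc a (double c) ⟨
    homogeneous (suc a) (suc (double c)) ∎
    where open ≗-Reasoning

-- Weighted enumeration of partitions

sumOver : {A : Set} → (A → ℤ) → List A → ℤ
sumOver φ []       = 0ℤ
sumOver φ (x ∷ xs) = φ x ℤ.+ sumOver φ xs

sumOver-cong : ∀ {A : Set} {φ ψ : A → ℤ} → φ ≗ ψ → sumOver φ ≗ sumOver ψ
sumOver-cong p []       = refl
sumOver-cong p (x ∷ xs) = cong₂ ℤ._+_ (p x) (sumOver-cong p xs)

sumOver-map : ∀ {A B : Set} (φ : B → ℤ) (f : A → B) xs →
              sumOver φ (map f xs) ≡ sumOver (φ ∘ f) xs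
sumOver-map φ f []       = refl
sumOver-map φ f (x ∷ xs) = cong (ℤ._+_ (φ (f x))) (sumOver-map φ f xs)

sumOver-++ : ∀ {A : Set} (φ : A → ℤ) xs ys →
             sumOver φ (xs ++ ys) ≡ sumOver φ xs ℤ.+ sumOver φ ys
sumOver-++ φ []       ys = sym (ℤ.+-identityˡ _)
sumOver-++ φ (x ∷ xs) ys =
  trans (cong (ℤ._+_ (φ x)) (sumOver-++ φ xs ys)) (sym (ℤ.+-assoc (φ x) _ _))

sumOver-concatMap : ∀ {A B : Set} (φ : B → ℤ) (f : A → List B) xs →
  sumOver φ (concatMap f xs) ≡ sumOver (sumOver φ ∘ f) xs
sumOver-concatMap φ f []       = refl
sumOver-concatMap φ f (x ∷ xs) =
  trans (sumOver-++ φ (f x) (concatMap f xs))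
        (cong (ℤ._+_ (sumOver φ (f x))) (sumOver-concatMap φ f xs))

weigh : ℕ → (List ℕ → ℤ) → Series
weigh m φ n = sumOver φ (partitionsBounded m n)

weigh-unfold : ∀ m φ n → weigh (suc m) φ n ≡
  sumOver (λ k → weigh m (λ ys → φ (replicate k (suc m) ++ ys)) (n ∸ k * suc m))
          (upTo (suc (n / suc m)))
weigh-unfold m φ n = trans
  (sumOver-concatMap φ (λ k → map (replicate k (suc m) ++_) (partitionsBounded m (n ∸ k * suc m)))
                     (upTo (suc (n / suc m))))
  (sumOver-cong (λ k → sumOver-map φ (replicate k (suc m) ++_)
                                   (partitionsBounded m (n ∸ k * suc m)))
                (upTo (suc (n / suc m))))

sumOver-upTo-suc : ∀ φ K → sumOver φ (upTo (suc K)) ≡ φ 0 ℤ.+ sumOver (φ ∘ suc) (upTo K)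
sumOver-upTo-suc φ K = cong (ℤ._+_ (φ 0))
  (trans (cong (sumOver φ) (sym (map-applyUpTo id suc K))) (sumOver-map φ suc (upTo K)))

-- The part `m + 1` is absent, or one copy of it can be removed and the rest still has parts at most
-- `m + 1`. The sum over multiplicities thus becomes a recursion on single parts, in which the
-- removed part is absorbed into the weight.
weigh-suc : ∀ m φ →
  weigh (suc m) φ ≗ weigh m φ +ˢ shift (suc m) (weigh (suc m) (φ ∘ (suc m ∷_)))
weigh-suc m φ n = trans (weigh-unfold m φ n)
  (trans (sumOver-upTo-suc block (n / suc m)) (cong (ℤ._+_ (weigh m φ n)) rest))
  where
  block : ℕ → ℤ
  block k = weigh m (λ ys → φ (replicate k (suc m) ++ ys)) (n ∸ k * suc m)

  ψ : List ℕ → ℤ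
  ψ = φ ∘ (suc m ∷_)

  rest : sumOver (block ∘ suc) (upTo (n / suc m)) ≡ shift (suc m) (weigh (suc m) ψ) n
  rest with suc m ≤? n
  ... | no  x≰n rewrite m<n⇒m/n≡0 {n} {suc m} (≰⇒> x≰n) =
    sym (shift-< (suc m) (weigh (suc m) ψ) (≰⇒> x≰n))
  ... | yes x≤n = begin
    sumOver (block ∘ suc) (upTo (n / suc m))
      ≡⟨ cong (λ q → sumOver (block ∘ suc) (upTo q)) (m/n≡1+[m∸n]/n x≤n) ⟩
    sumOver (block ∘ suc) (upTo (suc (n′ / suc m)))
      ≡⟨ sumOver-cong (λ k → cong (weigh m (λ ys → ψ (replicate k (suc m) ++ ys)))
                                   (sym (∸-+-assoc n (suc m) (k * suc m))))
                      (upTo (suc (n′ / suc m))) ⟩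
    sumOver (λ k → weigh m (λ ys → ψ (replicate k (suc m) ++ ys)) (n′ ∸ k * suc m))
            (upTo (suc (n′ / suc m)))
      ≡⟨ weigh-unfold m ψ n′ ⟨
    weigh (suc m) ψ n′
      ≡⟨ shift-+ (suc m) (weigh (suc m) ψ) n′ ⟨
    shift (suc m) (weigh (suc m) ψ) (suc m + n′)
      ≡⟨ cong (shift (suc m) (weigh (suc m) ψ)) (m+[n∸m]≡n x≤n) ⟩
    shift (suc m) (weigh (suc m) ψ) n ∎
    where
    open ≡-Reasoning
    n′ = n ∸ suc m

-- Parts larger than `n` cannot occur in a partition of `n`. The bound on the parts may therefore be
-- raised until the evaluations of `pairs` and `strict` apply.
weigh-stable : ∀ k φ n → weigh (k + n) φ n ≡ weigh n φ n
weigh-stable zero    φ n = refl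
weigh-stable (suc k) φ n = begin
  weigh (suc k + n) φ n
    ≡⟨ weigh-suc (k + n) φ n ⟩
  weigh (k + n) φ n ℤ.+ shift (suc (k + n)) (weigh (suc (k + n)) (φ ∘ (suc (k + n) ∷_))) n
    ≡⟨ cong (ℤ._+_ (weigh (k + n) φ n)) (shift-< (suc (k + n)) _ (s≤s (m≤n+m n k))) ⟩
  weigh (k + n) φ n ℤ.+ 0ℤ
    ≡⟨ ℤ.+-identityʳ _ ⟩
  weigh (k + n) φ n
    ≡⟨ weigh-stable k φ n ⟩
  weigh n φ n ∎
  where open ≡-Reasoning

-- The members of the lists partitionsBounded m n, n arbitrary.
data Descending : ℕ → List ℕ → Set where
  []    : Descending 0 []
  block : ∀ {m ys} k → Descending m ys → Descending (suc m) (replicate k (suc m) ++ ys)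

weigh-cong : ∀ m {φ ψ} → (∀ {xs} → Descending m xs → φ xs ≡ ψ xs) → weigh m φ ≗ weigh m ψ
weigh-cong zero    p zero    = cong (ℤ._+ 0ℤ) (p [])
weigh-cong zero    p (suc n) = refl
weigh-cong (suc m) {φ} {ψ} p n = trans (weigh-unfold m φ n)
  (trans (sumOver-cong (λ k → weigh-cong m (λ d → p (block k d)) (n ∸ k * suc m))
                       (upTo (suc (n / suc m))))
         (sym (weigh-unfold m ψ n)))

weigh-+ : ∀ m φ ψ → weigh m (λ xs → φ xs ℤ.+ ψ xs) ≗ weigh m φ +ˢ weigh m ψ
weigh-+ m φ ψ n = go (partitionsBounded m n)
  where
  interchange : ∀ w x y z → (w ℤ.+ x) ℤ.+ (y ℤ.+ z) ≡ (w ℤ.+ y) ℤ.+ (x ℤ.+ z)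
  interchange = solve-∀
  go : ∀ xs → sumOver (λ x → φ x ℤ.+ ψ x) xs ≡ sumOver φ xs ℤ.+ sumOver ψ xs
  go []       = refl
  go (x ∷ xs) = trans (cong (ℤ._+_ (φ x ℤ.+ ψ x)) (go xs)) (interchange (φ x) (ψ x) _ _)

weigh-- : ∀ m φ ψ → weigh m (λ xs → φ xs ℤ.- ψ xs) ≗ weigh m φ -ˢ weigh m ψ
weigh-- m φ ψ n = go (partitionsBounded m n)
  where
  interchange : ∀ w x y z → (w ℤ.- x) ℤ.+ (y ℤ.- z) ≡ (w ℤ.+ y) ℤ.- (x ℤ.+ z)
  interchange = solve-∀
  go : ∀ xs → sumOver (λ x → φ x ℤ.- ψ x) xs ≡ sumOver φ xs ℤ.- sumOver ψ xs
  go []       = refl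
  go (x ∷ xs) = trans (cong (ℤ._+_ (φ x ℤ.- ψ x)) (go xs)) (interchange (φ x) (ψ x) _ _)

weigh-0 : ∀ m → weigh m (λ _ → 0ℤ) ≗ 0ˢ
weigh-0 m n = go (partitionsBounded m n)
  where
  go : ∀ xs → sumOver (λ _ → 0ℤ) xs ≡ 0ℤ
  go []       = refl
  go (_ ∷ xs) = trans (ℤ.+-identityˡ _) (go xs)

-- The statistics of a partition, one block of equal parts at a time

descending-bounded : ∀ {m xs} → Descending m xs → All (_< suc m) xs
descending-bounded []            = []
descending-bounded (block k d) =
  All.++⁺ (All.replicate⁺ k ≤-refl) (All.map m<n⇒m<1+n (descending-bounded d))

filter-cong-local : ∀ {P Q : Pred ℕ 0ℓ} (P? : Decidable P) (Q? : Decidable Q) {xs} →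
  All (λ x → does (P? x) ≡ does (Q? x)) xs → filter P? xs ≡ filter Q? xs
filter-cong-local P? Q? []                = refl
filter-cong-local P? Q? {x ∷ _} (p ∷ ps) rewrite p with does (Q? x)
... | true  = cong (x ∷_) (filter-cong-local P? Q? ps)
... | false = filter-cong-local P? Q? ps

filter-∷ : ∀ {P : Pred ℕ 0ℓ} (P? : Decidable P) {x xs b} → does (P? x) ≡ b →
  filter P? (x ∷ xs) ≡ (if b then x ∷ filter P? xs else filter P? xs)
filter-∷ P? {x} refl with does (P? x)
... | true  = refl
... | false = refl

module _ {x : ℕ} {ys : List ℕ} (ys<x : All (_< x) ys) where

  multiplicity-self : ∀ k → multiplicity (replicate k x ++ ys) x ≡ k
  multiplicity-self zero    =
    cong length (filter-none (x ≟_) (All.map >⇒≢ ys<x))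
  multiplicity-self (suc k) =
    trans (cong length (filter-accept (x ≟_) refl)) (cong suc (multiplicity-self k))

  multiplicity-other : ∀ k {y} → y < x →
                       multiplicity (replicate k x ++ ys) y ≡ multiplicity ys y
  multiplicity-other zero    y<x = refl
  multiplicity-other (suc k) {y} y<x =
    trans (cong length (filter-reject (y ≟_) (<⇒≢ y<x))) (multiplicity-other k y<x)

  sizes-block : ∀ k → sizes (replicate (suc k) x ++ ys) ≡ x ∷ sizes ys
  sizes-block zero    = cong (x ∷_)
    (filter-all (λ y → ¬? (x ≟ y)) (All.map >⇒≢ (All.deduplicate⁺ _≟_ ys<x)))
  sizes-block (suc k) = cong (x ∷_) (begin
    filter (λ y → ¬? (x ≟ y)) (sizes (replicate (suc k) x ++ ys))
      ≡⟨ cong (filter (λ y → ¬? (x ≟ y))) (sizes-block k) ⟩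
    filter (λ y → ¬? (x ≟ y)) (x ∷ sizes ys)
      ≡⟨ filter-reject (λ y → ¬? (x ≟ y)) (λ x≢x → x≢x refl) ⟩
    filter (λ y → ¬? (x ≟ y)) (sizes ys)
      ≡⟨ filter-all (λ y → ¬? (x ≟ y)) (All.map >⇒≢ (All.deduplicate⁺ _≟_ ys<x)) ⟩
    sizes ys ∎)
    where open ≡-Reasoning

  unpaired-block : ∀ k → unpaired (replicate k x ++ ys) ≡
    (if does (k % 2 ≟ 1) then x ∷ unpaired ys else unpaired ys)
  unpaired-block zero    = refl
  unpaired-block (suc k) = trans (cong (filter odd?) (sizes-block k)) first
    where
    xs : List ℕ
    xs = replicate (suc k) x ++ ys
    odd? : (y : ℕ) → _
    odd? y = multiplicity xs y % 2 ≟ 1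
    others : filter odd? (sizes ys) ≡ unpaired ys
    others = filter-cong-local odd? (λ y → multiplicity ys y % 2 ≟ 1)
      (All.map (λ y<x → cong (λ c → does (c % 2 ≟ 1)) (multiplicity-other (suc k) y<x))
               (All.deduplicate⁺ _≟_ ys<x))
    first : filter odd? (x ∷ sizes ys) ≡
            (if does (suc k % 2 ≟ 1) then x ∷ unpaired ys else unpaired ys)
    first = trans
      (filter-∷ odd? (cong (λ c → does (c % 2 ≟ 1)) (multiplicity-self (suc k))))
      (cong (λ us → if does (suc k % 2 ≟ 1) then x ∷ us else us) others)

  pairSpan-block : ∀ k → pairSpan (replicate k x ++ ys) ≡ 2 * (k / 2) + pairSpan ys
  pairSpan-block zero    = refl
  pairSpan-block (suc k) = begin
    sum (map paired (sizes xs))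
      ≡⟨ cong (sum ∘ map paired) (sizes-block k) ⟩
    2 * (multiplicity xs x / 2) + sum (map paired (sizes ys))
      ≡⟨ cong₂ _+_ (cong (λ c → 2 * (c / 2)) (multiplicity-self (suc k)))
           (cong sum (map-cong-local
             (All.map (λ y<x → cong (λ c → 2 * (c / 2)) (multiplicity-other (suc k) y<x))
                      (All.deduplicate⁺ _≟_ ys<x)))) ⟩
    2 * (suc k / 2) + pairSpan ys ∎
    where
    open ≡-Reasoning
    xs : List ℕ
    xs = replicate (suc k) x ++ ys
    paired : ℕ → ℕ
    paired y = 2 * (multiplicity xs y / 2)

  private
    paired : ℕ → List ℕ
    paired k = filter (λ y → 2 ≤? multiplicity (replicate k x ++ ys) y) (replicate k x ++ ys)

    paired-++ : ∀ k → paired k ≡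
      filter (λ y → 2 ≤? multiplicity (replicate k x ++ ys) y) (replicate k x)
      ++ filter (λ y → 2 ≤? multiplicity ys y) ys
    paired-++ k = trans (filter-++ _ (replicate k x) ys)
      (cong (filter (λ y → 2 ≤? multiplicity (replicate k x ++ ys) y) (replicate k x) ++_)
        (filter-cong-local _ _
          (All.map (λ y<x → cong (λ c → does (2 ≤? c)) (multiplicity-other k y<x)) ys<x)))

  largestPaired-single : largestPaired (x ∷ ys) ≡ largestPaired ys
  largestPaired-single = cong (max 0) (trans (paired-++ 1)
    (cong (_++ filter (λ y → 2 ≤? multiplicity ys y) ys)
      (filter-none (λ y → 2 ≤? multiplicity (x ∷ ys) y) {x ∷ []}
        ((λ p → 1+n≰n (subst (2 ≤_) (multiplicity-self 1) p)) ∷ []))))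

  largestPaired-multiple : ∀ k → largestPaired (replicate (2 + k) x ++ ys) ≡ x
  largestPaired-multiple k = trans (cong (max 0) (trans (paired-++ (2 + k))
    (cong (_++ zs)
      (filter-all (λ y → 2 ≤? multiplicity (replicate (2 + k) x ++ ys) y)
        (All.replicate⁺ (2 + k)
          (subst (2 ≤_) (sym (multiplicity-self (2 + k))) (s≤s (s≤s z≤n))))))))
    (max≈v⁺ {xs = replicate (2 + k) x ++ zs} (here refl)
      (All.++⁺ (All.replicate⁺ (2 + k) ≤-refl)
               (All.filter⁺ (λ y → 2 ≤? multiplicity ys y) (All.map <⇒≤ ys<x)))
      z≤n)
    where
    zs : List ℕ
    zs = filter (λ y → 2 ≤? multiplicity ys y) ys

module _ {m : ℕ} {xs : List ℕ} (d : Descending m xs) where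

  unpaired-single : unpaired (suc m ∷ xs) ≡ suc m ∷ unpaired xs
  unpaired-single = unpaired-block (descending-bounded d) 1

  pairSpan-single : pairSpan (suc m ∷ xs) ≡ pairSpan xs
  pairSpan-single = pairSpan-block (descending-bounded d) 1

unpaired-pair : ∀ {m xs} → Descending (suc m) xs →
                unpaired (suc m ∷ suc m ∷ xs) ≡ unpaired xs
-- `(2 + k) % 2` reduces to `k % 2`, so both block formulas end in the same conditional.
unpaired-pair (block k d) = trans
  (unpaired-block (descending-bounded d) (2 + k))
  (sym (unpaired-block (descending-bounded d) k))

pairSpan-pair : ∀ {m xs} → Descending (suc m) xs →
                pairSpan (suc m ∷ suc m ∷ xs) ≡ 2 + pairSpan xs
pairSpan-pair {m} (block {ys = ys} k d) = begin
  pairSpan (replicate (2 + k) (suc m) ++ ys)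
    ≡⟨ pairSpan-block (descending-bounded d) (2 + k) ⟩
  2 * ((2 + k) / 2) + pairSpan ys
    ≡⟨ cong (λ h → 2 * h + pairSpan ys) (m/n≡1+[m∸n]/n {2 + k} {2} (s≤s (s≤s z≤n))) ⟩
  2 * suc (k / 2) + pairSpan ys
    ≡⟨ cong (_+ pairSpan ys) (*-suc 2 (k / 2)) ⟩
  2 + (2 * (k / 2) + pairSpan ys)
    ≡⟨ cong (2 +_) (pairSpan-block (descending-bounded d) k) ⟨
  2 + pairSpan (replicate k (suc m) ++ ys) ∎
  where open ≡-Reasoning

largestPaired-pair : ∀ {m xs} → Descending (suc m) xs →
                     largestPaired (suc m ∷ suc m ∷ xs) ≡ suc m
largestPaired-pair (block k d) = largestPaired-multiple (descending-bounded d) k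

-- Splitting a partition into its pairs and its unpaired parts

constant : ℤ → Series
constant c zero    = c
constant c (suc n) = 0ℤ

-- Strict partitions δ into parts ≤ m, weighted by β δ q^|δ|.
strict : ℕ → (List ℕ → ℤ) → Series
strict zero    β = constant (β [])
strict (suc m) β = strict m β +ˢ shift (suc m) (strict m (β ∘ (suc m ∷_)))

head₀ : List ℕ → ℕ
head₀ []      = 0
head₀ (x ∷ _) = x

-- Partitions μ into parts ≤ m, one part for each pair, weighted by
-- q^(2|μ|) and by α at the largest part and the number of paired parts.
pairs : ℕ → (ℕ → ℕ → ℤ) → Series
pairs m α = dilate (weigh m (λ xs → α (head₀ xs) (double (length xs))))

weigh-zero : ∀ φ → weigh 0 φ ≗ constant (φ [])
weigh-zero φ zero    = ℤ.+-identityʳ (φ [])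
weigh-zero φ (suc n) = refl

pairs-zero : ∀ α → pairs 0 α ≗ constant (α 0 0)
pairs-zero α zero          = ℤ.+-identityʳ (α 0 0)
pairs-zero α (suc zero)    = refl
pairs-zero α (suc (suc n)) = dilate-0ˢ n

constant-*ˢ : ∀ c d → constant c *ˢ constant d ≗ constant (c ℤ.* d)
constant-*ˢ c d zero    = ℤ.+-identityʳ (c ℤ.* d)
constant-*ˢ c d (suc n) = cong₂ ℤ._+_ (ℤ.*-zeroʳ c) (*ˢ-zeroˡ (constant d) n)

-- Once a pair of size `m + 1` has been removed, the largest paired size is known to be `m + 1`
-- whatever remains. The weight of the remainder therefore ignores its first argument and only
-- counts two more paired parts.
pairs-suc : ∀ m α → pairs (suc m) α ≗
  pairs m α +ˢ shift (double (suc m)) (pairs (suc m) (λ _ p → α (suc m) (2 + p)))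
pairs-suc m α = begin
  dilate (weigh (suc m) φ)
    ≈⟨ dilate-cong (weigh-suc m φ) ⟩
  dilate (weigh m φ +ˢ shift (suc m) (weigh (suc m) (φ ∘ (suc m ∷_))))
    ≈⟨ dilate-+ˢ (weigh m φ) (shift (suc m) (weigh (suc m) (φ ∘ (suc m ∷_)))) ⟩
  dilate (weigh m φ) +ˢ dilate (shift (suc m) (weigh (suc m) (φ ∘ (suc m ∷_))))
    ≈⟨ +ˢ-cong (≗-refl {dilate (weigh m φ)})
               (dilate-shift (suc m) (weigh (suc m) (φ ∘ (suc m ∷_)))) ⟩
  dilate (weigh m φ) +ˢ shift (double (suc m)) (dilate (weigh (suc m) (φ ∘ (suc m ∷_)))) ∎
  where
  open ≗-Reasoning
  φ : List ℕ → ℤ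
  φ xs = α (head₀ xs) (double (length xs))

separated : (ℕ → ℕ → ℤ) → (List ℕ → ℤ) → List ℕ → ℤ
separated α β xs = α (largestPaired xs) (pairSpan xs) ℤ.* β (unpaired xs)

-- The part `m + 1` occurs not at all, exactly once, or at least twice. The first two cases are the
-- two branches of `strict (suc m) β` over the same `pairs m α`. In the third a pair is removed,
-- which leaves the unpaired parts unchanged and yields the second branch of `pairs-suc`. That case
-- keeps `m` and changes `α`, so an inner well-founded induction on the exponent `n`, for all `α`,
-- complements the induction on `m`.
weigh-separated : ∀ m α β → weigh m (separated α β) ≗ pairs m α *ˢ strict m β
weigh-separated zero    α β = begin
  weigh 0 (separated α β)           ≈⟨ weigh-zero (separated α β) ⟩
  constant (α 0 0 ℤ.* β [])         ≈⟨ constant-*ˢ (α 0 0) (β []) ⟨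
  constant (α 0 0) *ˢ constant (β []) ≈⟨ *ˢ-cong (pairs-zero α) (≗-refl {constant (β [])}) ⟨
  pairs 0 α *ˢ constant (β [])      ∎
  where open ≗-Reasoning
weigh-separated (suc m) α β n = <-rec
  (λ n → ∀ α → weigh (suc m) (separated α β) n ≡ (pairs (suc m) α *ˢ strict (suc m) β) n)
  step n α
  where
  x = suc m
  step : ∀ n → (∀ {j} → j < n → ∀ α →
         weigh x (separated α β) j ≡ (pairs x α *ˢ strict x β) j) →
         ∀ α → weigh x (separated α β) n ≡ (pairs x α *ˢ strict x β) n
  step n ih α = begin
    weigh x φ n
      ≡⟨ weigh-suc m φ n ⟩
    (weigh m φ +ˢ shift x (weigh x (φ ∘ (x ∷_)))) n
      ≡⟨ +ˢ-cong (≗-refl {weigh m φ})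
           (≗-trans (shift-cong x (weigh-suc m (φ ∘ (x ∷_))))
                    (shift-+ˢ x (weigh m (φ ∘ (x ∷_))) (shift x (weigh x (φ ∘ (x ∷_) ∘ (x ∷_)))))) n ⟩
    (weigh m φ +ˢ (shift x (weigh m (φ ∘ (x ∷_)))
       +ˢ shift x (shift x (weigh x (φ ∘ (x ∷_) ∘ (x ∷_)))))) n
      ≡⟨ cong₂ ℤ._+_ (weigh-separated m α β n) (cong₂ ℤ._+_ (single n) pair) ⟩
    (P *ˢ Q +ˢ (shift x (P *ˢ Q′) +ˢ shift (double x) (pairs x α′ *ˢ strict x β))) n
      ≡⟨ +ˢ-assoc (P *ˢ Q) (shift x (P *ˢ Q′)) (shift (double x) (pairs x α′ *ˢ strict x β)) n ⟨
    ((P *ˢ Q +ˢ shift x (P *ˢ Q′)) +ˢ shift (double x) (pairs x α′ *ˢ strict x β)) n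
      ≡⟨ cong (ℤ._+ shift (double x) (pairs x α′ *ˢ strict x β) n) (merge n) ⟨
    (P *ˢ strict x β +ˢ shift (double x) (pairs x α′ *ˢ strict x β)) n
      ≡⟨ cong (ℤ._+_ ((P *ˢ strict x β) n)) (shift-*ˢ (double x) (pairs x α′) (strict x β) n) ⟨
    (P *ˢ strict x β +ˢ shift (double x) (pairs x α′) *ˢ strict x β) n
      ≡⟨ *ˢ-distribʳ-+ˢ (strict x β) P (shift (double x) (pairs x α′)) n ⟨
    ((P +ˢ shift (double x) (pairs x α′)) *ˢ strict x β) n
      ≡⟨ *ˢ-cong (pairs-suc m α) (≗-refl {strict x β}) n ⟨
    (pairs x α *ˢ strict x β) n ∎
    where
    open ≡-Reasoning
    φ = separated α β
    P = pairs m α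
    Q = strict m β
    Q′ = strict m (β ∘ (x ∷_))
    α′ : ℕ → ℕ → ℤ
    α′ _ p = α x (2 + p)

    merge : P *ˢ strict x β ≗ P *ˢ Q +ˢ shift x (P *ˢ Q′)
    merge = ≗-trans (*ˢ-distribˡ-+ˢ P Q (shift x Q′))
                    (+ˢ-cong (≗-refl {P *ˢ Q}) (*ˢ-shift x P Q′))

    single : shift x (weigh m (φ ∘ (x ∷_))) ≗ shift x (P *ˢ Q′)
    single = shift-cong x (≗-trans
      (weigh-cong m (λ d → cong₂ ℤ._*_
        (cong₂ α (largestPaired-single (descending-bounded d)) (pairSpan-single d))
        (cong β (unpaired-single d))))
      (weigh-separated m α (β ∘ (x ∷_))))

    pair : shift x (shift x (weigh x (φ ∘ (x ∷_) ∘ (x ∷_)))) n ≡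
           shift (double x) (pairs x α′ *ˢ strict x β) n
    pair = begin
      shift x (shift x (weigh x (φ ∘ (x ∷_) ∘ (x ∷_)))) n
        ≡⟨ shift-cong x (shift-cong x (weigh-cong x (λ d → cong₂ ℤ._*_
             (cong₂ α (largestPaired-pair d) (pairSpan-pair d)) (cong β (unpaired-pair d))))) n ⟩
      shift x (shift x (weigh x (separated α′ β))) n
        ≡⟨ shift-shift x x (weigh x (separated α′ β)) n ⟩
      shift (x + x) (weigh x (separated α′ β)) n
        -- `x + x` is `suc (m + x)`, a positive shift, so coefficient `n` sees only smaller
        -- exponents of the unshifted series.
        ≡⟨ shift-cong-< (m + x) n (λ j<n → ih j<n α′) ⟩
      shift (x + x) (pairs x α′ *ˢ strict x β) n
        ≡⟨ shift-exponent (pairs x α′ *ˢ strict x β) (double≡+ x) n ⟨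
      shift (double x) (pairs x α′ *ˢ strict x β) n ∎

-- Iverson brackets

⟦_⟧ : {P : Set} → Dec P → ℤ
⟦ P? ⟧ = if does P? then 1ℤ else 0ℤ

module _ {P Q : Set} where

  ⟦⟧-cong : (P? : Dec P) (Q? : Dec Q) → (P → Q) → (Q → P) → ⟦ P? ⟧ ≡ ⟦ Q? ⟧
  ⟦⟧-cong (yes p) (yes q) f g = refl
  ⟦⟧-cong (yes p) (no ¬q) f g = contradiction (f p) ¬q
  ⟦⟧-cong (no ¬p) (yes q) f g = contradiction (g q) ¬p
  ⟦⟧-cong (no ¬p) (no ¬q) f g = refl

  ⟦⟧-×-dec : (P? : Dec P) (Q? : Dec Q) → ⟦ P? ×-dec Q? ⟧ ≡ ⟦ P? ⟧ ℤ.* ⟦ Q? ⟧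
  ⟦⟧-×-dec (yes _) (yes _) = refl
  ⟦⟧-×-dec (yes _) (no _)  = refl
  ⟦⟧-×-dec (no _)  (yes _) = refl
  ⟦⟧-×-dec (no _)  (no _)  = refl

⟦⟧-true : {P : Set} (P? : Dec P) → P → ⟦ P? ⟧ ≡ 1ℤ
⟦⟧-true (yes _) p = refl
⟦⟧-true (no ¬p) p = contradiction p ¬p

⟦⟧-false : {P : Set} (P? : Dec P) → ¬ P → ⟦ P? ⟧ ≡ 0ℤ
⟦⟧-false (yes p) ¬p = contradiction p ¬p
⟦⟧-false (no _)  ¬p = refl

⟦⟧-guard : {P : Set} (P? : Dec P) {x y : ℤ} → (P → x ≡ y) → ⟦ P? ⟧ ℤ.* x ≡ ⟦ P? ⟧ ℤ.* y
⟦⟧-guard (yes p) f = cong (1ℤ ℤ.*_) (f p)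
⟦⟧-guard (no _)  f = refl

length-filter-⟦⟧ : {A : Set} {P : Pred A 0ℓ} (P? : Decidable P) (xs : List A) →
  (ℤ.+ length (filter P? xs)) ≡ sumOver (λ x → ⟦ P? x ⟧) xs
length-filter-⟦⟧ P? []       = refl
length-filter-⟦⟧ P? (x ∷ xs) with does (P? x)
... | true  = trans (ℤ.pos-+ 1 (length (filter P? xs)))
                    (cong (ℤ._+_ 1ℤ) (length-filter-⟦⟧ P? xs))
... | false = trans (length-filter-⟦⟧ P? xs) (sym (ℤ.+-identityˡ _))

constant-1 : constant 1ℤ ≗ 1ˢ
constant-1 zero    = refl
constant-1 (suc n) = refl

double-mono-≤ : ∀ {a b} → a ≤ b → double a ≤ double b
double-mono-≤ z≤n     = z≤n
double-mono-≤ (s≤s p) = s≤s (s≤s (double-mono-≤ p))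

double-cancel-≤ : ∀ a b → double a ≤ suc (double b) → a ≤ b
double-cancel-≤ zero    b       p             = z≤n
double-cancel-≤ (suc a) zero    (s≤s ())
double-cancel-≤ (suc a) (suc b) (s≤s (s≤s p)) = s≤s (double-cancel-≤ a b p)

-- Strict partitions by alternating sum

data Strict : ℕ → List ℕ → Set where
  []   : Strict 0 []
  skip : ∀ {m δ} → Strict m δ → Strict (suc m) δ
  take : ∀ {m δ} → Strict m δ → Strict (suc m) (suc m ∷ δ)

strict-cong : ∀ m {β β′} → (∀ {δ} → Strict m δ → β δ ≡ β′ δ) → strict m β ≗ strict m β′
strict-cong zero    p zero    = p []
strict-cong zero    p (suc n) = refl
strict-cong (suc m) p = +ˢ-cong (strict-cong m (p ∘ skip))
                                (shift-cong (suc m) (strict-cong m (p ∘ take)))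

strict-0 : ∀ m → strict m (λ _ → 0ℤ) ≗ 0ˢ
strict-0 zero    zero    = refl
strict-0 zero    (suc n) = refl
strict-0 (suc m) = ≗-trans
  (+ˢ-cong (strict-0 m) (≗-trans (shift-cong (suc m) (strict-0 m)) (shift-0ˢ (suc m))))
  (+ˢ-identityˡ 0ˢ)

strict-vanish : ∀ m {β} → (∀ {δ} → Strict m δ → β δ ≡ 0ℤ) → strict m β ≗ 0ˢ
strict-vanish m p = ≗-trans (strict-cong m p) (strict-0 m)

strict-extend : ∀ m {β} → (∀ {δ} → Strict m δ → β (suc m ∷ δ) ≡ 0ℤ) →
                strict (suc m) β ≗ strict m β
strict-extend m {β} p = ≗-trans
  (+ˢ-cong (≗-refl {strict m β})
           (≗-trans (shift-cong (suc m) (strict-vanish m p)) (shift-0ˢ (suc m))))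
  (+ˢ-identityʳ (strict m β))

-- The truncated subtraction is exact on strict partitions.
alt : List ℕ → ℕ
alt []       = 0
alt (u ∷ us) = u ∸ alt us

-- For δ nonempty, excess δ = 1 + (u₁ - s), and the residual span is
-- 2 (u₁ - s) + 1 = 2 excess δ - 1.
excess : List ℕ → ℕ
excess []       = 0
excess (u ∷ us) = suc (alt us)

alt-≤ : ∀ {m δ} → Strict m δ → alt δ ≤ m
alt-≤ []       = z≤n
alt-≤ (skip d) = m≤n⇒m≤1+n (alt-≤ d)
alt-≤ {suc m} {_ ∷ δ} (take d) = m∸n≤m (suc m) (alt δ)

-- For nonempty `δ` the sum is exactly the largest part plus one, because the alternating sum of the
-- tail cancels.
alt+excess : ∀ {m δ} → Strict m δ → alt δ + excess δ ≤ suc m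
alt+excess []       = z≤n
alt+excess (skip d) = m≤n⇒m≤1+n (alt+excess d)
alt+excess {suc m} {_ ∷ δ} (take d) = ≤-reflexive
  (trans (+-suc (suc m ∸ alt δ) (alt δ)) (cong suc (m∸n+n≡m (m≤n⇒m≤1+n (alt-≤ d)))))

-- A largest part `m + 1 = i + 1 + j` gives alternating sum `i + 1` exactly when the rest has
-- alternating sum `j`. By induction and symmetry the rest contributes `q^j` times a Gaussian
-- binomial in q², and `(m + 1) + j = (i + 1) + 2j` makes the recursion the Pascal rule in q².
-- Alternating sum 0 occurs only for the empty partition.
strict-alt : ∀ m i j → i + j ≡ m →
  strict m (λ δ → ⟦ alt δ ≟ i ⟧) ≗ shift i (dilate (gauss i j))
strict-alt zero    zero    zero    eq = ≗-trans constant-1 (≗-sym dilate-1ˢ)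
strict-alt (suc m) zero    (suc j) eq = ≗-trans
  (strict-extend m (λ d → ⟦⟧-false (_ ≟ 0) (λ p → <⇒≱ (s≤s (alt-≤ d)) (m∸n≡0⇒m≤n p))))
  (strict-alt m zero j (suc-injective eq))
strict-alt (suc m) (suc i) j eq = ≗-trans
  (+ˢ-cong (≗-refl {strict m (λ δ → ⟦ alt δ ≟ suc i ⟧)})
           (shift-cong (suc m) (strict-cong m top)))
  (split j eq)
  where
  top : ∀ {δ} → Strict m δ → ⟦ suc m ∸ alt δ ≟ suc i ⟧ ≡ ⟦ alt δ ≟ j ⟧
  top {δ} d = ⟦⟧-cong (suc m ∸ alt δ ≟ suc i) (alt δ ≟ j)
    (λ p → begin
      alt δ                     ≡⟨ m∸[m∸n]≡n (m≤n⇒m≤1+n (alt-≤ d)) ⟨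
      suc m ∸ (suc m ∸ alt δ)   ≡⟨ cong₂ _∸_ (sym eq) p ⟩
      suc i + j ∸ suc i         ≡⟨ m+n∸m≡n (suc i) j ⟩
      j                         ∎)
    (λ p → trans (cong₂ _∸_ (sym eq) p) (m+n∸n≡m (suc i) j))
    where open ≡-Reasoning

  split : ∀ j → suc i + j ≡ suc m →
    strict m (λ δ → ⟦ alt δ ≟ suc i ⟧) +ˢ shift (suc m) (strict m (λ δ → ⟦ alt δ ≟ j ⟧))
    ≗ shift (suc i) (dilate (gauss (suc i) j))
  -- Here `i = m`, so alternating sum `i + 1` is out of reach for parts at most `m`; only the
  -- partition with the single part `m + 1` remains.
  split zero eq = begin
    strict m (λ δ → ⟦ alt δ ≟ suc i ⟧) +ˢ shift (suc m) (strict m (λ δ → ⟦ alt δ ≟ 0 ⟧))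
      ≈⟨ +ˢ-cong (strict-vanish m (λ {δ} d → ⟦⟧-false (alt δ ≟ suc i)
                   (λ p → <⇒≱ (s≤s (alt-≤ d)) (≤-reflexive (trans m≡i (sym p))))))
                 (shift-cong (suc m) (strict-alt m 0 m refl)) ⟩
    0ˢ +ˢ shift (suc m) (dilate 1ˢ)
      ≈⟨ +ˢ-identityˡ (shift (suc m) (dilate 1ˢ)) ⟩
    shift (suc m) (dilate 1ˢ)
      ≈⟨ shift-exponent (dilate 1ˢ) m≡i ⟩
    shift (suc i) (dilate 1ˢ) ∎
    where
    open ≗-Reasoning
    m≡i : suc m ≡ suc i
    m≡i = trans (sym eq) (+-identityʳ (suc i))
  split (suc j) eq = begin
    strict m (λ δ → ⟦ alt δ ≟ suc i ⟧) +ˢ shift (suc m) (strict m (λ δ → ⟦ alt δ ≟ suc j ⟧))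
      ≈⟨ +ˢ-cong (strict-alt m (suc i) j (trans (sym (+-suc i j)) (suc-injective eq)))
                 (shift-cong (suc m) (strict-alt m (suc j) i
                   (trans (+-comm (suc j) i) (suc-injective eq)))) ⟩
    shift (suc i) G +ˢ shift (suc m) (shift (suc j) (dilate (gauss (suc j) i)))
      ≈⟨ +ˢ-cong (≗-refl {shift (suc i) G})
           (shift-cong (suc m) (shift-cong (suc j) (dilate-cong (gauss-comm (suc j) i)))) ⟩
    shift (suc i) G +ˢ shift (suc m) (shift (suc j) H)
      ≈⟨ +ˢ-cong (≗-refl {shift (suc i) G}) exponents ⟩
    shift (suc i) G +ˢ shift (suc i) (shift (double (suc j)) H)
      ≈⟨ shift-+ˢ (suc i) G (shift (double (suc j)) H) ⟨
    shift (suc i) (G +ˢ shift (double (suc j)) H)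
      ≈⟨ shift-cong (suc i)
           (≗-trans (dilate-+ˢ (gauss (suc i) j) (shift (suc j) (gauss i (suc j))))
                    (+ˢ-cong (≗-refl {G}) (dilate-shift (suc j) (gauss i (suc j))))) ⟨
    shift (suc i) (dilate (gauss (suc i) (suc j))) ∎
    where
    open ≗-Reasoning
    G H : Series
    G = dilate (gauss (suc i) j)
    H = dilate (gauss i (suc j))
    exponents : shift (suc m) (shift (suc j) H) ≗ shift (suc i) (shift (double (suc j)) H)
    exponents = begin
      shift (suc m) (shift (suc j) H)           ≈⟨ shift-shift (suc m) (suc j) H ⟩
      shift (suc m + suc j) H                   ≈⟨ shift-exponent H sums ⟩
      shift (suc i + double (suc j)) H          ≈⟨ shift-shift (suc i) (double (suc j)) H ⟨
      shift (suc i) (shift (double (suc j)) H)  ∎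
      where
      sums : suc m + suc j ≡ suc i + double (suc j)
      sums = trans (cong (_+ suc j) (sym eq))
        (trans (+-assoc (suc i) (suc j) (suc j)) (cong (suc i +_) (sym (double≡+ (suc j)))))

altExcess : ℕ → ℕ → List ℕ → ℤ
altExcess s c δ = ⟦ alt δ ≟ s ⟧ ℤ.* ⟦ excess δ ≤? c ⟧

-- With alternating sum `s > 0` fixed, `excess δ ≤ c` says that the largest part is at most
-- `s + c - 1`. For parts bounded by exactly this number the condition on `excess` is automatic and
-- `strict-alt` applies; `go` then shows that admitting larger parts adds nothing.
strict-altExcess : ∀ m s c → s + c ≤ m → strict m (altExcess s c) ≗ oddHomogeneous s c
strict-altExcess m zero c _ = ≗-trans (go m) (≗-sym (oddHomogeneous-zero c))
  where
  go : ∀ m → strict m (altExcess 0 c) ≗ 1ˢ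
  go zero    = constant-1
  go (suc m) = ≗-trans
    (strict-extend m (λ {δ} d → cong (ℤ._* ⟦ suc (alt δ) ≤? c ⟧)
      (⟦⟧-false (suc m ∸ alt δ ≟ 0) (λ p → <⇒≱ (s≤s (alt-≤ d)) (m∸n≡0⇒m≤n p)))))
    (go m)
strict-altExcess m (suc s) zero _ = strict-vanish m (λ {δ} _ → vanish δ)
  where
  vanish : ∀ δ → altExcess (suc s) 0 δ ≡ 0ℤ
  vanish []      = refl
  vanish (u ∷ δ) = ℤ.*-zeroʳ ⟦ u ∸ alt δ ≟ suc s ⟧
strict-altExcess m (suc s) (suc c) s+c≤m =
  subst (λ m → strict m (altExcess (suc s) (suc c)) ≗ oddHomogeneous (suc s) (suc c))
        (m∸n+n≡m (≤-trans (+-monoʳ-≤ (suc s) (n≤1+n c)) s+c≤m))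
        (go (m ∸ (suc s + c)))
  where
  go : ∀ k → strict (k + (suc s + c)) (altExcess (suc s) (suc c)) ≗
             oddHomogeneous (suc s) (suc c)
  go zero    = ≗-trans (strict-cong (suc s + c) bounded) (strict-alt (suc s + c) (suc s) c refl)
    where
    bounded : ∀ {δ} → Strict (suc s + c) δ → altExcess (suc s) (suc c) δ ≡ ⟦ alt δ ≟ suc s ⟧
    bounded {δ} d = trans
      (⟦⟧-guard (alt δ ≟ suc s) (λ p → ⟦⟧-true (excess δ ≤? suc c)
        (+-cancelˡ-≤ (suc s) (excess δ) (suc c)
          (subst₂ _≤_ (cong (_+ excess δ) p) (sym (+-suc (suc s) c)) (alt+excess d)))))
      (ℤ.*-identityʳ ⟦ alt δ ≟ suc s ⟧)
  go (suc k) = ≗-trans (strict-extend m′ vanish) (go k)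
    where
    m′ = k + (suc s + c)
    vanish : ∀ {δ} → Strict m′ δ → altExcess (suc s) (suc c) (suc m′ ∷ δ) ≡ 0ℤ
    vanish {δ} d = trans
      (⟦⟧-guard (suc m′ ∸ alt δ ≟ suc s) (λ p → ⟦⟧-false (suc (alt δ) ≤? suc c) λ q →
        <⇒≱ (s≤s (m≤n+m (suc s + c) k)) (begin
          suc m′                         ≡⟨ m∸n+n≡m (m≤n⇒m≤1+n (alt-≤ d)) ⟨
          suc m′ ∸ alt δ + alt δ         ≡⟨ cong (_+ alt δ) p ⟩
          suc s + alt δ                  ≤⟨ +-monoʳ-≤ (suc s) (≤-pred q) ⟩
          suc s + c                      ∎)))
      (ℤ.*-zeroʳ ⟦ suc m′ ∸ alt δ ≟ suc s ⟧)
      where open ≤-Reasoning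

-- Partitions by largest part and number of parts

weigh-vanish : ∀ m {φ} → (∀ {xs} → Descending m xs → φ xs ≡ 0ℤ) → weigh m φ ≗ 0ˢ
weigh-vanish m p = ≗-trans (weigh-cong m p) (weigh-0 m)

weigh-extend : ∀ m {φ} → (∀ xs → φ (suc m ∷ xs) ≡ 0ℤ) → weigh (suc m) φ ≗ weigh m φ
weigh-extend m {φ} p = ≗-trans (weigh-suc m φ) (≗-trans
  (+ˢ-cong (≗-refl {weigh m φ})
           (≗-trans (shift-cong (suc m) (weigh-vanish (suc m) (λ {xs} _ → p xs)))
                    (shift-0ˢ (suc m))))
  (+ˢ-identityʳ (weigh m φ)))

head₀-≤ : ∀ {m xs} → Descending m xs → head₀ xs ≤ m
head₀-≤ []                = z≤n
head₀-≤ (block zero d)    = m≤n⇒m≤1+n (head₀-≤ d)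
head₀-≤ (block (suc k) d) = ≤-refl

-- Removing a part `m + 1` lowers the permitted number of parts by one and keeps the bound on their
-- size, so `weigh-suc` matches the conjugate Pascal rule. The doubling is there because each part
-- stands for two paired parts.
weigh-length : ∀ m c → weigh m (λ xs → ⟦ double (length xs) ≤? double c ⟧) ≗ gauss m c
weigh-length zero    c       = ≗-trans (weigh-zero (λ xs → ⟦ double (length xs) ≤? double c ⟧)) constant-1
weigh-length (suc m) zero    = ≗-trans
  (weigh-extend m (λ _ → refl))
  (≗-trans (weigh-length m 0) (gauss-zeroʳ m))
weigh-length (suc m) (suc c) = begin
  weigh (suc m) φ
    ≈⟨ weigh-suc m φ ⟩
  weigh m φ +ˢ shift (suc m) (weigh (suc m) (φ ∘ (suc m ∷_)))
    ≈⟨ +ˢ-cong (weigh-length m (suc c))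
         (shift-cong (suc m) (≗-trans
           (weigh-cong (suc m) λ {xs} _ → ⟦⟧-cong (2 + double (length xs) ≤? 2 + double c)
             (double (length xs) ≤? double c) (≤-pred ∘ ≤-pred) (s≤s ∘ s≤s))
           (weigh-length (suc m) c))) ⟩
  gauss m (suc c) +ˢ shift (suc m) (gauss (suc m) c)
    ≈⟨ gauss-pascal′ m c ⟨
  gauss (suc m) (suc c) ∎
  where
  open ≗-Reasoning
  φ : List ℕ → ℤ
  φ xs = ⟦ double (length xs) ≤? double (suc c) ⟧

rankSpan : ℕ → ℕ → ℕ → ℕ → ℤ
rankSpan r c R p = ⟦ R ≟ r ⟧ ℤ.* ⟦ p ≤? double c ⟧

-- For `r > 0`, removing the largest part `r` leaves an arbitrary partition with at most `c - 1`
-- parts, each at most `r`. This gives `q^r` times a Gaussian binomial, which is the form in which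
-- `homogeneous` is defined; for `c = 0` nothing is left.
weigh-head-length : ∀ m r c → r ≤ m →
  weigh m (λ xs → rankSpan r c (head₀ xs) (double (length xs))) ≗ homogeneous r c
weigh-head-length m zero c _ = ≗-trans (go m) (≗-sym (homogeneous-zero c))
  where
  go : ∀ m → weigh m (λ xs → rankSpan 0 c (head₀ xs) (double (length xs))) ≗ 1ˢ
  go zero    = ≗-trans (weigh-zero (λ xs → rankSpan 0 c (head₀ xs) (double (length xs)))) constant-1
  go (suc m) = ≗-trans (weigh-extend m (λ _ → refl)) (go m)
weigh-head-length m (suc r) c r<m =
  subst (λ m → weigh m φ ≗ homogeneous (suc r) c) (m∸n+n≡m r<m) (go (m ∸ suc r))
  where
  φ : List ℕ → ℤ
  φ xs = rankSpan (suc r) c (head₀ xs) (double (length xs))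

  largest : ∀ c → shift (suc r) (weigh (suc r) (λ xs → ⟦ double (suc (length xs)) ≤? double c ⟧))
                ≗ homogeneous (suc r) c
  largest zero    = ≗-trans (shift-cong (suc r) (weigh-0 (suc r))) (shift-0ˢ (suc r))
  largest (suc c) = shift-cong (suc r) (≗-trans
    (weigh-cong (suc r) λ {xs} _ → ⟦⟧-cong (2 + double (length xs) ≤? 2 + double c)
      (double (length xs) ≤? double c) (≤-pred ∘ ≤-pred) (s≤s ∘ s≤s))
    (weigh-length (suc r) c))

  go : ∀ k → weigh (k + suc r) φ ≗ homogeneous (suc r) c
  go zero    = begin
    weigh (suc r) φ
      ≈⟨ weigh-suc r φ ⟩
    weigh r φ +ˢ shift (suc r) (weigh (suc r) (φ ∘ (suc r ∷_)))
      ≈⟨ +ˢ-cong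
           (weigh-vanish r (λ {xs} d → cong (ℤ._* ⟦ double (length xs) ≤? double c ⟧)
             (⟦⟧-false (head₀ xs ≟ suc r) (<⇒≢ (s≤s (head₀-≤ d))))))
           (≗-trans (shift-cong (suc r) (weigh-cong (suc r) λ {xs} _ →
             trans (cong (ℤ._* ⟦ double (suc (length xs)) ≤? double c ⟧) (⟦⟧-true (suc r ≟ suc r) refl))
                   (ℤ.*-identityˡ _)))
             (largest c)) ⟩
    0ˢ +ˢ homogeneous (suc r) c
      ≈⟨ +ˢ-identityˡ (homogeneous (suc r) c) ⟩
    homogeneous (suc r) c ∎
    where open ≗-Reasoning
  go (suc k) = ≗-trans
    (weigh-extend (k + suc r) λ xs → cong (ℤ._* ⟦ double (suc (length xs)) ≤? double c ⟧)
      (⟦⟧-false (suc (k + suc r) ≟ suc r) (λ p → <⇒≢ (s≤s (m≤n+m (suc r) k)) (sym p))))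
    (go k)

pairs-rankSpan : ∀ m r c → r ≤ m → pairs m (rankSpan r c) ≗ evenHomogeneous r c
pairs-rankSpan m r c r≤m = dilate-cong (weigh-head-length m r c r≤m)

-- Partitions by pairing index and pairing width

convolveℤ : (ℕ → ℤ) → (ℕ → ℤ) → ℕ → ℤ
convolveℤ e o zero    = e 0 ℤ.* o 0
convolveℤ e o (suc a) = e 0 ℤ.* o (suc a) ℤ.+ convolveℤ (e ∘ suc) o a

convolveℤ-0 : ∀ o a → convolveℤ (λ _ → 0ℤ) o a ≡ 0ℤ
convolveℤ-0 o zero    = refl
convolveℤ-0 o (suc a) = trans (ℤ.+-identityˡ _) (convolveℤ-0 o a)

-- Only the term with `r = R` and `s = A` can survive. Read from right to left, this turns a
-- condition on the sum `R + A` into a sum of products, each of the shape that `weigh-separated`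
-- requires.
convolveℤ-⟦⟧ : ∀ R A x y a →
  convolveℤ (λ r → ⟦ R ≟ r ⟧ ℤ.* x) (λ s → ⟦ A ≟ s ⟧ ℤ.* y) a ≡
  ⟦ R + A ≟ a ⟧ ℤ.* (x ℤ.* y)
convolveℤ-⟦⟧ zero    A x y a = trans (only-first a) (assoc ⟦ A ≟ a ⟧ x y)
  where
  assoc : ∀ i x y → (1ℤ ℤ.* x) ℤ.* (i ℤ.* y) ≡ i ℤ.* (x ℤ.* y)
  assoc = solve-∀
  only-first : ∀ a → convolveℤ (λ r → ⟦ 0 ≟ r ⟧ ℤ.* x) (λ s → ⟦ A ≟ s ⟧ ℤ.* y) a ≡
                     (1ℤ ℤ.* x) ℤ.* (⟦ A ≟ a ⟧ ℤ.* y)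
  only-first zero    = refl
  only-first (suc a) = trans
    (cong (ℤ._+_ ((1ℤ ℤ.* x) ℤ.* (⟦ A ≟ suc a ⟧ ℤ.* y))) (convolveℤ-0 (λ s → ⟦ A ≟ s ⟧ ℤ.* y) a))
    (ℤ.+-identityʳ _)
convolveℤ-⟦⟧ (suc R) A x y zero    = refl
convolveℤ-⟦⟧ (suc R) A x y (suc a) = trans (ℤ.+-identityˡ _) (convolveℤ-⟦⟧ R A x y a)

weigh-convolveℤ : ∀ m (α : ℕ → ℕ → ℕ → ℤ) (β : ℕ → List ℕ → ℤ) a →
  weigh m (λ xs → convolveℤ (λ r → α r (largestPaired xs) (pairSpan xs)) (λ s → β s (unpaired xs)) a)
  ≗ convolve (λ r → pairs m (α r)) (λ s → strict m (β s)) a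
weigh-convolveℤ m α β zero    = weigh-separated m (α 0) (β 0)
weigh-convolveℤ m α β (suc a) = ≗-trans
  (weigh-+ m (separated (α 0) (β (suc a)))
     (λ xs → convolveℤ (λ r → α (suc r) (largestPaired xs) (pairSpan xs)) (λ s → β s (unpaired xs)) a))
  (+ˢ-cong (weigh-separated m (α 0) (β (suc a))) (weigh-convolveℤ m (α ∘ suc) β a))

convolve-cong-≤ : ∀ {E E′ O O′} a → (∀ {r} → r ≤ a → E r ≗ E′ r) → (∀ {s} → s ≤ a → O s ≗ O′ s) →
                  convolve E O a ≗ convolve E′ O′ a
convolve-cong-≤ zero    p q = *ˢ-cong (p z≤n) (q z≤n)
convolve-cong-≤ (suc a) p q = +ˢ-cong (*ˢ-cong (p z≤n) (q ≤-refl))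
  (convolve-cong-≤ a (p ∘ s≤s) (q ∘ m≤n⇒m≤1+n))

-- `c` and `c′` are `b / 2` rounded down and up, the numbers of even and of odd exponents among 1,
-- ..., b. An even span is at most `b` iff it is at most `2c`, and the odd span `2 excess δ - 1` is
-- at most `b` iff `excess δ ≤ c′`.
data Halves : ℕ → ℕ → ℕ → Set where
  even : ∀ c → Halves (double c) c c
  odd  : ∀ c → Halves (suc (double c)) c (suc c)

halves : ∀ b → ∃ λ c → ∃ λ c′ → Halves b c c′
halves zero    = 0 , 0 , even 0
halves (suc b) with halves b
... | c , _ , even _ = c , suc c , odd c
... | c , _ , odd _  = suc c , suc c , even (suc c)

residual : List ℕ → ℕ
residual []       = 0
residual (u ∷ us) = suc (double (alt us))

convolve-halves : ∀ {b c c′} → Halves b c c′ → ∀ a →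
                  convolve (evens c) (odds c′) a ≗ homogeneous a b
convolve-halves (even c) = convolve-evens-odds c
convolve-halves (odd c)  = convolve-evens-odds⁺ c

module _ {b c c′ : ℕ} where

  double-≤-halves : Halves b c c′ → ∀ h →
    (double h ≤ b → double h ≤ double c) × (double h ≤ double c → double h ≤ b)
  double-≤-halves (even c) h = id , id
  double-≤-halves (odd c)  h = (λ p → double-mono-≤ (double-cancel-≤ h c p)) , m≤n⇒m≤1+n

  residual-≤-halves : Halves b c c′ → ∀ δ →
    (residual δ ≤ b → excess δ ≤ c′) × (excess δ ≤ c′ → residual δ ≤ b)
  residual-≤-halves _        []      = (λ _ → z≤n) , (λ _ → z≤n)
  residual-≤-halves (even c) (u ∷ δ) =
    (λ p → double-cancel-≤ (suc (alt δ)) c (s≤s p)) ,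
    (λ p → ≤-trans (n≤1+n _) (double-mono-≤ p))
  residual-≤-halves (odd c)  (u ∷ δ) =
    (λ p → s≤s (double-cancel-≤ (alt δ) c (m≤n⇒m≤1+n (≤-pred p)))) ,
    (λ p → s≤s (double-mono-≤ (≤-pred p)))

pairSpan-even : ∀ xs → ∃ λ h → pairSpan xs ≡ double h
pairSpan-even xs = go (sizes xs)
  where
  go : ∀ zs → ∃ λ h → sum (map (λ z → 2 * (multiplicity xs z / 2)) zs) ≡ double h
  go []       = 0 , refl
  go (z ∷ zs) with go zs
  ... | h , p = multiplicity xs z / 2 + h , trans (cong (2 * k +_) p) (begin
    2 * k + double h       ≡⟨ cong (2 * k +_) (2*≡double h) ⟨
    2 * k + 2 * h          ≡⟨ *-distribˡ-+ 2 k h ⟨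
    2 * (k + h)            ≡⟨ 2*≡double (k + h) ⟩
    double (k + h)         ∎)
    where
    open ≡-Reasoning
    k = multiplicity xs z / 2
    2*≡double : ∀ n → 2 * n ≡ double n
    2*≡double n = trans (cong (n +_) (+-identityʳ n)) (sym (double≡+ n))

index width : List ℕ → ℕ
index xs = largestPaired xs + alt (unpaired xs)
width xs = pairSpan xs ⊔ residual (unpaired xs)

⟦width≤⟧ : ∀ {b c c′} → Halves b c c′ → ∀ xs →
  ⟦ width xs ≤? b ⟧ ≡ ⟦ pairSpan xs ≤? double c ⟧ ℤ.* ⟦ excess (unpaired xs) ≤? c′ ⟧
⟦width≤⟧ {b} {c} {c′} H xs with pairSpan-even xs
... | h , eq rewrite eq = trans
  (⟦⟧-cong (double h ⊔ residual δ ≤? b) (double h ≤? double c ×-dec excess δ ≤? c′)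
    (λ p → proj₁ (double-≤-halves H h) (m⊔n≤o⇒m≤o (double h) (residual δ) p)
         , proj₁ (residual-≤-halves H δ) (m⊔n≤o⇒n≤o (double h) (residual δ) p))
    (λ (p , q) → ⊔-lub (proj₂ (double-≤-halves H h) p) (proj₂ (residual-≤-halves H δ) q)))
  (⟦⟧-×-dec (double h ≤? double c) (excess δ ≤? c′))
  where δ = unpaired xs

atMost : ℕ → ℕ → List ℕ → ℤ
atMost a b xs = ⟦ index xs ≟ a ⟧ ℤ.* ⟦ width xs ≤? b ⟧

weigh-atMost : ∀ a b n → weigh n (atMost a b) n ≡ homogeneous a b n
weigh-atMost a b n with halves b
... | c , c′ , H = begin
  weigh n (atMost a b) n
    -- The bound `a + c′ + n` satisfies `r ≤ m` and `s + c′ ≤ m` for all `r, s ≤ a`, as the two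
    -- evaluations below demand.
    ≡⟨ weigh-stable (a + c′) (atMost a b) n ⟨
  weigh m (atMost a b) n
    ≡⟨ weigh-cong m (λ {xs} _ → trans
         (cong (⟦ index xs ≟ a ⟧ ℤ.*_) (⟦width≤⟧ H xs))
         (sym (convolveℤ-⟦⟧ (largestPaired xs) (alt (unpaired xs)) _ _ a))) n ⟩
  weigh m (λ xs → convolveℤ (λ r → rankSpan r c (largestPaired xs) (pairSpan xs))
                            (λ s → altExcess s c′ (unpaired xs)) a) n
    ≡⟨ weigh-convolveℤ m (λ r → rankSpan r c) (λ s → altExcess s c′) a n ⟩
  convolve (λ r → pairs m (rankSpan r c)) (λ s → strict m (altExcess s c′)) a n
    ≡⟨ convolve-cong-≤ {E′ = evens c} {O′ = odds c′} a
         (λ {r} r≤a → pairs-rankSpan m r c (≤-trans r≤a a≤m))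
         (λ {s} s≤a → strict-altExcess m s c′ (≤-trans (+-monoˡ-≤ c′ s≤a) (m≤m+n (a + c′) n))) n ⟩
  convolve (evens c) (odds c′) a n
    ≡⟨ convolve-halves H a n ⟩
  homogeneous a b n ∎
  where
  open ≡-Reasoning
  m = a + c′ + n
  a≤m : a ≤ m
  a≤m = ≤-trans (m≤m+n a c′) (m≤m+n (a + c′) n)

-- Agreement with the integer-valued statistics

strict-unpaired : ∀ {m xs} → Descending m xs → Strict m (unpaired xs)
strict-unpaired []          = []
strict-unpaired {suc m} (block {ys = ys} k d)
  rewrite unpaired-block (descending-bounded d) k with does (k % 2 ≟ 1)
... | true  = take (strict-unpaired d)
... | false = skip (strict-unpaired d)

alternatingSum≡alt : ∀ {m δ} → Strict m δ → alternatingSum δ ≡ (ℤ.+ alt δ)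
alternatingSum≡alt []       = refl
alternatingSum≡alt (skip d) = alternatingSum≡alt d
alternatingSum≡alt {suc m} {_ ∷ δ} (take d) = begin
  (ℤ.+ suc m) ℤ.- alternatingSum δ ≡⟨ cong (ℤ._-_ (ℤ.+ suc m)) (alternatingSum≡alt d) ⟩
  (ℤ.+ suc m) ℤ.- (ℤ.+ alt δ)      ≡⟨ ℤ.[+m]-[+n]≡m⊖n (suc m) (alt δ) ⟩
  suc m ℤ.⊖ alt δ                  ≡⟨ ℤ.⊖-≥ (m≤n⇒m≤1+n (alt-≤ d)) ⟩
  (ℤ.+ (suc m ∸ alt δ))            ∎
  where open ≡-Reasoning

residualSpanOf≡residual : ∀ {m δ} → Strict m δ → residualSpanOf δ ≡ (ℤ.+ residual δ)
residualSpanOf≡residual []       = refl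
residualSpanOf≡residual (skip d) = residualSpanOf≡residual d
residualSpanOf≡residual {suc m} {_ ∷ δ} (take d) = begin
  residualSpanOf (suc m ∷ δ)
    ≡⟨ cancel (ℤ.+ suc m) (alternatingSum δ) ⟩
  1ℤ ℤ.+ (alternatingSum δ ℤ.+ alternatingSum δ)
    ≡⟨ cong (λ t → 1ℤ ℤ.+ (t ℤ.+ t)) (alternatingSum≡alt d) ⟩
  (ℤ.+ suc (alt δ + alt δ))
    ≡⟨ cong (λ t → ℤ.+ suc t) (double≡+ (alt δ)) ⟨
  (ℤ.+ residual (suc m ∷ δ)) ∎
  where
  open ≡-Reasoning
  cancel : ∀ u t → (ℤ.+ 2) ℤ.* (u ℤ.- (u ℤ.- t)) ℤ.+ 1ℤ ≡ 1ℤ ℤ.+ (t ℤ.+ t)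
  cancel = solve-∀

⟦≟⟧-difference : ∀ w b → ⟦ w ≟ suc b ⟧ ≡ ⟦ w ≤? suc b ⟧ ℤ.- ⟦ w ≤? b ⟧
⟦≟⟧-difference w b with w ≤? b
... | yes p = trans (⟦⟧-false (w ≟ suc b) (<⇒≢ (s≤s p)))
  (sym (cong₂ ℤ._-_ (⟦⟧-true (w ≤? suc b) (m≤n⇒m≤1+n p)) (⟦⟧-true (w ≤? b) p)))
... | no ¬p = trans
  (⟦⟧-cong (w ≟ suc b) (w ≤? suc b) ≤-reflexive (λ q → ≤-antisym q (≰⇒> ¬p)))
  (sym (trans (cong (ℤ._-_ ⟦ w ≤? suc b ⟧) (⟦⟧-false (w ≤? b) ¬p)) (ℤ.+-identityʳ _)))

⟦index×width⟧ : ∀ a b {m xs} → Descending m xs →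
  ⟦ (pairingIndex xs ℤ.≟ (ℤ.+ a)) ×-dec (pairingWidth xs ℤ.≟ (ℤ.+ suc b)) ⟧
  ≡ atMost a (suc b) xs ℤ.- atMost a b xs
⟦index×width⟧ a b {m} {xs} d = begin
  ⟦ (pairingIndex xs ℤ.≟ (ℤ.+ a)) ×-dec (pairingWidth xs ℤ.≟ (ℤ.+ suc b)) ⟧
    ≡⟨ ⟦⟧-×-dec (pairingIndex xs ℤ.≟ (ℤ.+ a)) (pairingWidth xs ℤ.≟ (ℤ.+ suc b)) ⟩
  ⟦ pairingIndex xs ℤ.≟ (ℤ.+ a) ⟧ ℤ.* ⟦ pairingWidth xs ℤ.≟ (ℤ.+ suc b) ⟧
    ≡⟨ cong₂ ℤ._*_
         (⟦⟧-cong (pairingIndex xs ℤ.≟ (ℤ.+ a)) (index xs ≟ a)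
           (λ p → ℤ.+-injective (trans (sym index≡) p))
           (λ p → trans index≡ (cong ℤ.+_ p)))
         (⟦⟧-cong (pairingWidth xs ℤ.≟ (ℤ.+ suc b)) (width xs ≟ suc b)
           (λ p → ℤ.+-injective (trans (sym width≡) p))
           (λ p → trans width≡ (cong ℤ.+_ p))) ⟩
  ⟦ index xs ≟ a ⟧ ℤ.* ⟦ width xs ≟ suc b ⟧
    ≡⟨ cong (⟦ index xs ≟ a ⟧ ℤ.*_) (⟦≟⟧-difference (width xs) b) ⟩
  ⟦ index xs ≟ a ⟧ ℤ.* (⟦ width xs ≤? suc b ⟧ ℤ.- ⟦ width xs ≤? b ⟧)
    ≡⟨ distrib ⟦ index xs ≟ a ⟧ ⟦ width xs ≤? suc b ⟧ ⟦ width xs ≤? b ⟧ ⟩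
  atMost a (suc b) xs ℤ.- atMost a b xs ∎
  where
  open ≡-Reasoning
  distrib : ∀ i x y → i ℤ.* (x ℤ.- y) ≡ i ℤ.* x ℤ.- i ℤ.* y
  distrib = solve-∀
  index≡ : pairingIndex xs ≡ (ℤ.+ index xs)
  index≡ = cong (ℤ._+_ (ℤ.+ largestPaired xs)) (alternatingSum≡alt (strict-unpaired d))
  width≡ : pairingWidth xs ≡ (ℤ.+ width xs)
  width≡ = cong (ℤ._⊔_ (ℤ.+ pairSpan xs)) (residualSpanOf≡residual (strict-unpaired d))

generatingFunction-N : ∀ a b →
  generatingFunction (N (suc a) (suc b)) ≗ shift (suc b) (homogeneous a (suc b))
generatingFunction-N a b n = begin
  generatingFunction (N (suc a) (suc b)) n
    ≡⟨ length-filter-⟦⟧ (λ xs → (pairingIndex xs ℤ.≟ (ℤ.+ suc a)) ×-dec (pairingWidth xs ℤ.≟ (ℤ.+ suc b)))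
                        (partitions n) ⟩
  weigh n (λ xs → ⟦ (pairingIndex xs ℤ.≟ (ℤ.+ suc a)) ×-dec (pairingWidth xs ℤ.≟ (ℤ.+ suc b)) ⟧) n
    ≡⟨ weigh-cong n (⟦index×width⟧ (suc a) b) n ⟩
  weigh n (λ xs → atMost (suc a) (suc b) xs ℤ.- atMost (suc a) b xs) n
    ≡⟨ weigh-- n (atMost (suc a) (suc b)) (atMost (suc a) b) n ⟩
  weigh n (atMost (suc a) (suc b)) n ℤ.- weigh n (atMost (suc a) b) n
    -- For `b = 0` the subtracted term is a polynomial of positive degree in no variables, hence
    -- zero: a positive index forces a positive width.
    ≡⟨ cong₂ ℤ._-_ (weigh-atMost (suc a) (suc b) n) (weigh-atMost (suc a) b n) ⟩
  homogeneous (suc a) (suc b) n ℤ.- homogeneous (suc a) b n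
    ≡⟨ cong (ℤ._- homogeneous (suc a) b n) (homogeneous-suc a b n) ⟩
  (homogeneous (suc a) b +ˢ shift (suc b) (homogeneous a (suc b))) n ℤ.- homogeneous (suc a) b n
    ≡⟨ cancel (homogeneous (suc a) b n) (shift (suc b) (homogeneous a (suc b)) n) ⟩
  shift (suc b) (homogeneous a (suc b)) n ∎
  where
  open ≡-Reasoning
  cancel : ∀ x y → (x ℤ.+ y) ℤ.- x ≡ y
  cancel = solve-∀

mainTheorem4 : ∀ (a b : ℕ) → 1 ≤ a → 1 ≤ b →
    generatingFunction (N a b) ≗ q^ (a + b ∸ 1) *ˢ gaussianBinomial (a + b ∸ 2) (a ∸ 1)
mainTheorem4 (suc i) (suc j) _ _ = begin
  generatingFunction (N (suc i) (suc j))
    ≈⟨ generatingFunction-N i j ⟩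
  -- With `a = i + 1` and `b = j + 1`, the exponent `a + b - 1` collects `q^b` from the difference
  -- of the two width bounds and `q^(a-1)` from the degree of `homogeneous i (suc j)`.
  shift (suc j) (shift i (gauss i j))
    ≈⟨ shift-shift (suc j) i (gauss i j) ⟩
  shift (suc j + i) (gauss i j)
    ≈⟨ shift-exponent (gauss i j) (+-comm (suc j) i) ⟩
  shift (i + suc j) (gauss i j)
    ≈⟨ shift-cong (i + suc j) (gaussianBinomial≗gauss i j) ⟨
  shift (i + suc j) (gaussianBinomial (i + j) i)
    -- The upper index `a + b ∸ 2` of the statement reduces to `i + suc j ∸ 1`, which becomes
    -- `i + j` after rewriting by `+-suc`.
    ≡⟨ cong (λ e → shift (i + suc j) (gaussianBinomial (e ∸ 1) i)) (+-suc i j) ⟨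
  shift (i + suc j) G
    ≈⟨ shift-cong (i + suc j) (*ˢ-identityˡ G) ⟨
  shift (i + suc j) (1ˢ *ˢ G)
    ≈⟨ shift-*ˢ (i + suc j) 1ˢ G ⟨
  shift (i + suc j) 1ˢ *ˢ G
    ≈⟨ *ˢ-cong (q^≗shift (i + suc j)) (≗-refl {G}) ⟨
  q^ (i + suc j) *ˢ G ∎
  where
  open ≗-Reasoning
  G : Series
  G = gaussianBinomial (i + suc j ∸ 1) i
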